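{- $R(C_5, C_6, C_6) = 15$.
   Context: For graphs $G_1,\dots,G_k$, the multicolor Ramsey number $R(G_1,\dots,G_k)$ is the smallest $n$ such that every $k$-coloring of the edges of the complete graph $K_n$ (with colors $1,\dots,k$) contains, for some $i$, a copy of $G_i$ (as a not necessarily induced subgraph) all of whose edges have color $i$. $C_m$ denotes the cycle on $m$ vertices. -}

module Defs where

open import Data.Nat using (ℕ; zero; suc; _<_)
open import Data.Fin using (Fin; zero; suc)
open import Data.Product using (Σ; _×_; ∃)
open import Data.Sum using (_⊎_)
open import Relation.Binary.PropositionalEquality using (_≡_; _≢_)
open import Relation.Nullary using (¬_)
import Data.Empty
open import Function.Definitions using (Injective)

next : ∀ {m} → Fin (suc m) → Fin (suc m)
next {zero} zero = zero
next {suc m} zero = suc zero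
next {suc m} (suc i) with next {m} i
... | zero = zero
... | suc j = suc (suc j)

-- A k-colouring of the edges of the complete graph K_n on vertex set Fin n:
-- a colour for every ordered pair, symmetric on distinct vertices
-- (values on the diagonal are irrelevant).
record Colouring (k n : ℕ) : Set where
  field
    col : Fin n → Fin n → Fin k
    sym : ∀ {i j} → i ≢ j → col i j ≡ col j i
open Colouring public

HasMonoCycle : ∀ {k n} → Colouring k n → Fin k → ℕ → Set
HasMonoCycle c a zero = Data.Empty.⊥
HasMonoCycle {n = n} c a (suc m) =
  Σ (Fin (suc m) → Fin n) λ f →
    Injective _≡_ _≡_ f × (∀ i → col c (f i) (f (next i)) ≡ a)

Arrows : ∀ {k} → ℕ → (Fin k → ℕ) → Set
Arrows {k} n L = (c : Colouring k n) → ∃ λ a → HasMonoCycle c a (L a)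

IsCycleRamseyNumber : ∀ {k} → (Fin k → ℕ) → ℕ → Set
IsCycleRamseyNumber L N = Arrows N L × (∀ n → n < N → ¬ Arrows n L)

C566 : Fin 3 → ℕ
C566 zero = 5
C566 (suc zero) = 6
C566 (suc (suc zero)) = 6

{-# OPTIONS --safe #-}
module Submission where

open import Defs hiding (sym)
open import Data.Bool.Base using (Bool; true; false; _∧_; _∨_; not; if_then_else_; T)
open import Data.Bool.Properties using (∧-identityʳ; ∧-zeroʳ; ∨-comm; ¬-not)
open import Data.Empty using (⊥; ⊥-elim)
open import Data.Fin.Base as Fin using (Fin; zero; suc; toℕ; fromℕ<)
open import Data.Fin.Properties using (_≟_; any?; toℕ<n; toℕ-injective; fromℕ<-injective; pigeonhole)
open import Data.List.Base using (List; []; _∷_; map; _++_; length; concatMap; drop; lookup; allFin)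
open import Data.List.Membership.Propositional using (_∈_)
open import Data.List.Membership.Propositional.Properties using (∈-++⁺ˡ; ∈-++⁺ʳ; ∈-++⁻; ∈-map⁺; ∈-map⁻; ∈-concatMap⁺; ∈-allFin; ∈-lookup)
open import Data.List.Properties using (length-map; length-++; map-cong; map-∘)
open import Data.List.Relation.Binary.Permutation.Propositional using (_↭_; refl; prep; swap; trans; ↭-sym; ↭⇒↭ₛ)
open import Data.List.Relation.Binary.Permutation.Propositional.Properties using (shift; shifts; drop-∷; ∈-resp-↭; All-resp-↭; ↭-length; ++-comm; ++⁺ʳ)
import Data.List.Relation.Binary.Permutation.Setoid.Properties as Permₛ
open import Data.List.Relation.Unary.All as All using (All; []; _∷_)
open import Data.List.Relation.Unary.All.Properties using (map⁺; ++⁻ˡ)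
open import Data.List.Relation.Unary.AllPairs using (AllPairs; []; _∷_)
open import Data.List.Relation.Unary.Any as Any using (here; there)
open import Data.List.Relation.Unary.Unique.DecPropositional (_≟_ {15}) using (unique?)
open import Data.List.Relation.Unary.Unique.Propositional using (Unique)
open import Data.List.Relation.Unary.Unique.Propositional.Properties using (allFin⁺)
open import Data.Nat.Base using (ℕ; zero; suc; _+_; _*_; _∸_; _⊓_; _≤_; _<_; _<ᵇ_; _≤ᵇ_; z≤n; s≤s)
open import Data.Nat.Properties hiding (_≟_)
open import Data.Nat.Solver using (module +-*-Solver)
open import Data.Product.Base using (_×_; _,_; proj₁; proj₂; ∃; ∃₂)
open import Data.Sum.Base using (_⊎_; inj₁; inj₂)
open import Data.Unit.Base using (tt)
open import Function.Definitions using (Injective)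
open import Relation.Binary.PropositionalEquality using (_≡_; _≢_; refl; sym; cong; cong₂; subst; setoid) renaming (trans to ≡-trans)
open import Relation.Nullary using (Dec; yes; no; ¬_; does; _×-dec_)

-- Colours 0, 1 and 2 are called red, green and blue.
--
-- Lower bound: split the vertices into two blocks of at most 7, colour the edges between the blocks red,
-- and inside each block colour a K₅ green and everything else blue.
--
-- Upper bound: suppose that a colouring of K₁₅ has no such cycle. A C₆-free graph on 15 vertices has at
-- most 34 edges, and a C₅-free graph on 15 vertices without an independent 7-set has at most 36. As
-- 34 + 34 + 36 < 105, some set S of 7 vertices contains no red edge. No 8-set has this property, so there is
-- a red edge ww′ outside S. If x is a further vertex, then w and x, or w′ and x, have at most one common red
-- neighbour in S, since otherwise w a x b w′ is a red C₅ with a, b ∈ S. An exhaustive search shows that no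
-- such configuration S, w, x, w′ extends to 15 vertices.
--
-- All searches add one vertex at a time and keep roughly one representative of every isomorphism class.
-- For the edge bounds the added vertex is one of minimum degree: deleting a vertex of minimum degree from a
-- graph with n vertices and e edges leaves at least e - 2e/n edges, so few graphs have to be kept.

-- The number 7 comes from $R(C_6,C_6)=8$: a set without red edges is coloured green and blue only,
-- so it has at most 7 vertices. In the lower bound, two such blocks of 7 are joined by a bipartite,
-- hence C₅-free, red graph. The obstacle is that C₅ is odd. The red graph may be dense and
-- bipartite: K₇,₈ has 56 edges and no C₅, so C₅-freeness alone gives no useful bound. Such graphs
-- have large independent sets, which are red-free sets of the colouring. Red-free 7-sets are
-- therefore excluded first, and their absence enters the count of red edges as a constraint on
-- every added vertex. The three bounds then sum to 104, one less than the number of edges of K₁₅.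
-- The vertex x is arbitrary. As w and w′ are interchangeable, only the case where w and x have at
-- most one common red neighbour is searched. For every search what is proved is completeness: each
-- configuration appears in the list up to relabelling, so an empty list means that there is none.

private variable
  A C V : Set

-- Coloured graphs as triangular lists

-- A labelled graph with coloured edges: row i lists the colours of the edges from vertex i to the later vertices.
Pattern : Set → Set
Pattern C = List (List C)

-- An index that is too large denotes the last element, so that x ∷ xs is always a permutation of
-- select k x xs ∷ remove k x xs; rowAt and delete are the corresponding operations on patterns.
select : ℕ → A → List A → A
select zero    x xs       = x
select (suc k) x []       = x
select (suc k) x (y ∷ ys) = select k y ys

remove : ℕ → A → List A → List A
remove zero    x xs       = xs
remove (suc k) x []       = []
remove (suc k) x (y ∷ ys) = x ∷ remove k y ys

rowAt : ℕ → List C → Pattern C → List C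
rowAt zero    t        g       = t
rowAt (suc k) t        []      = t
rowAt (suc k) []       (r ∷ g) = []
rowAt (suc k) (c ∷ cs) (r ∷ g) = select k c cs ∷ rowAt k r g

delete : ℕ → List C → Pattern C → Pattern C
delete zero    t        g       = g
delete (suc k) t        []      = []
delete (suc k) []       (r ∷ g) = []
delete (suc k) (c ∷ cs) (r ∷ g) = remove k c cs ∷ delete k r g

reorder : List ℕ → List A → List A
reorder []       xs       = xs
reorder (k ∷ ks) []       = []
reorder (k ∷ ks) (x ∷ xs) = select k x xs ∷ reorder ks (remove k x xs)

-- Short paths and the conflicts of a new vertex

meets : List Bool → List Bool → Bool
meets (true  ∷ xs) (y ∷ ys) = y ∨ meets xs ys
meets (false ∷ xs) (y ∷ ys) = meets xs ys
meets _            _        = false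

-- path₃ us ws g and path₄ us ws g look for a path with 3 or 4 edges between two further vertices with
-- adjacency rows us and ws; the cases are the positions of the first vertex of g on the path. In fork us ws rs
-- the middle vertex of the path has row rs.
path₃ : List Bool → List Bool → Pattern Bool → Bool
path₃ (u ∷ us) (w ∷ ws) (t ∷ g) = (u ∧ meets ws t) ∨ ((w ∧ meets us t) ∨ path₃ us ws g)
path₃ _ _ _ = false

fork : List Bool → List Bool → List Bool → Bool
fork (u ∷ us) (w ∷ ws) (false ∷ rs) = fork us ws rs
fork (u ∷ us) (w ∷ ws) (true  ∷ rs) = (u ∧ meets ws rs) ∨ ((w ∧ meets us rs) ∨ fork us ws rs)
fork _ _ _ = false

path₄ : List Bool → List Bool → Pattern Bool → Bool
path₄ (u ∷ us) (w ∷ ws) (t ∷ g) =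
  (u ∧ path₃ t ws g) ∨ ((w ∧ path₃ us t g) ∨ (fork us ws t ∨ path₄ us ws g))
path₄ _ _ _ = false

-- Two vertices conflict if a forbidden cycle arises as soon as they have a common neighbour outside the pattern.
Test : Set
Test = List Bool → List Bool → Pattern Bool → Bool

-- The index `i` counts positions after one end of the pair has been deleted. The successor of that
-- end then stands at its old position, which is why row `i` of `conflictRows` starts again at `i`.
conflictsFrom : Test → ℕ → ℕ → List Bool → Pattern Bool → List Bool
conflictsFrom T i (suc m) (x ∷ xs) (t ∷ g) =
  T (remove i x xs) (rowAt i t g) (delete i t g) ∷ conflictsFrom T (suc i) m (x ∷ xs) (t ∷ g)
conflictsFrom T i _ _ _ = []

conflictRows : Test → ℕ → ℕ → List Bool → Pattern Bool → Pattern Bool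
conflictRows T i zero    t g = [] ∷ []
conflictRows T i (suc m) t g =
  conflictsFrom T i (suc m) (rowAt i t g) (delete i t g) ∷ conflictRows T (suc i) m t g

-- A cycle through a new vertex enters and leaves it by two of its neighbours. The possible
-- neighbourhoods are thus the independent sets of the conflict graph, which depends on the old
-- pattern only.
conflicts : Test → Pattern Bool → Pattern Bool
conflicts T []      = []
conflicts T (t ∷ g) = conflictRows T 0 (length g) t g

-- Normal forms and removal of duplicates

-- The vertices are sorted by a hash that is invariant under isomorphism, ties being broken arbitrarily.
-- Nothing depends on the quality of the hash: the result is a relabelling in any case.
module Normalise {C : Set} (weigh : C → ℕ → ℕ → ℕ) (same : C → C → Bool) where

  dot : List C → List ℕ → ℕ
  dot (c ∷ cs) (s ∷ ss) = weigh c s (dot cs ss)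
  dot _        _        = 0

  bump : ℕ → List C → List ℕ → List ℕ
  bump s (c ∷ cs) (a ∷ as) = weigh c s a ∷ bump s cs as
  bump s _        _        = []

  gather : Pattern C → List ℕ → List ℕ
  gather (t ∷ g) (s ∷ ss) = dot t ss ∷ bump s t (gather g ss)
  gather _       _        = []

  blend : List ℕ → List ℕ → List ℕ
  blend (c ∷ cs) (a ∷ as) = 3 * c + a ∷ blend cs as
  blend _        _        = []

  refine : Pattern C → List ℕ → List ℕ
  -- The quadratic term makes a sum over neighbours depend on more than the sum of their hashes;
  -- 7919 is an arbitrary prime, as is 104729 below.
  refine g cs = blend cs (gather g (map (λ c → c * (c + 7919)) cs))

  argmax : ℕ → ℕ → ℕ → List ℕ → ℕ
  argmax b k i []       = k
  argmax b k i (x ∷ xs) = if b <ᵇ x then argmax x i (suc i) xs else argmax b k (suc i) xs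

  attach : ℕ → List C → List ℕ × Pattern C → List ℕ × Pattern C
  attach k r (ks , h) = k ∷ ks , reorder ks r ∷ h

  -- The vertex of largest weight comes next, and the weights of the others are raised according to
  -- the colours of their edges to it. Vertices with equal hashes are thus told apart by their edges
  -- to those already placed. The choices are returned too, so that the result is visibly a
  -- `reorder`.
  sort   : ℕ → ℕ → List ℕ → Pattern C → List ℕ × Pattern C
  sortAt : ℕ → ℕ → ℕ → ℕ → List ℕ → List C → Pattern C → List ℕ × Pattern C
  attachTo : ℕ → ℕ → ℕ → List ℕ → List C → Pattern C → List ℕ × Pattern C
  sort (suc f) K (x ∷ xs) (t ∷ g) = sortAt f K (argmax x 0 1 xs) x xs t g
  sort _       _ _        g       = [] , g
  sortAt f K k x xs t g = attachTo f K k (remove k x xs) (rowAt k t g) (delete k t g)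
  attachTo f K k xs r g = attach k r (sort f (5 * K) (bump K r xs) g)

  -- Being independent of the order of the vertices, this number agrees for isomorphic patterns. It
  -- is the key of the search tree and decides between a pattern and its exchange.
  squares : List ℕ → ℕ
  squares []       = 0
  squares (c ∷ cs) = c * c + squares cs

  normAt : List ℕ → Pattern C → ℕ × Pattern C
  normAt cs g = squares cs , proj₂ (sort (length g) 104729 cs g)

  norm : List ℕ → Pattern C → ℕ × Pattern C
  norm cs g = normAt (refine g (refine g cs)) g

  sameRow : List C → List C → Bool
  sameRow (x ∷ xs) (y ∷ ys) = same x y ∧ sameRow xs ys
  sameRow []       []       = true
  sameRow _        _        = false

  samePattern : Pattern C → Pattern C → Bool
  samePattern (s ∷ g) (t ∷ h) = sameRow s t ∧ samePattern g h
  samePattern []      []      = true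
  samePattern _       _       = false

  data Tree : Set where
    leaf : Tree
    node : Tree → ℕ → List (Pattern C) → Tree → Tree

  member : Pattern C → List (Pattern C) → Bool
  member g []       = false
  member g (h ∷ hs) = samePattern g h ∨ member g hs

  insert : ℕ → Pattern C → Tree → Tree
  insert k g leaf = node leaf k (g ∷ []) leaf
  insert k g (node l j hs r) =
    if k <ᵇ j then node (insert k g l) j hs r else
    if j <ᵇ k then node l j hs (insert k g r) else
    node l j (if member g hs then hs else g ∷ hs) r

  toList : Tree → List (Pattern C)
  toList leaf            = []
  toList (node l j hs r) = toList l ++ (hs ++ toList r)

  collect : List (ℕ × Pattern C) → Tree
  collect []             = leaf
  collect ((k , g) ∷ gs) = insert k g (collect gs)

  dedup : List (ℕ × Pattern C) → List (Pattern C)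
  dedup gs = toList (collect gs)

-- Search for graphs with many edges

count : List Bool → ℕ
count []           = 0
count (true  ∷ xs) = suc (count xs)
count (false ∷ xs) = count xs

edges : Pattern Bool → ℕ
edges []      = 0
edges (t ∷ g) = count t + edges g

bumpBy : List Bool → List ℕ → List ℕ
bumpBy (true  ∷ bs) (d ∷ ds) = suc d ∷ bumpBy bs ds
bumpBy (false ∷ bs) (d ∷ ds) = d ∷ bumpBy bs ds
bumpBy _            _        = []

degrees : Pattern Bool → List ℕ
degrees []      = []
degrees (t ∷ g) = count t ∷ bumpBy t (degrees g)

allAbove : ℕ → List ℕ → Bool
allAbove d []       = true
allAbove d (x ∷ xs) = (d ≤ᵇ x) ∧ allAbove d xs

-- Bounds the degree of an added vertex of minimum degree: an old vertex of degree `d` has degree at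
-- most `suc d` afterwards.
cap : ℕ → List ℕ → ℕ
cap m []       = m
cap m (d ∷ ds) = suc d ⊓ cap m ds

grow : ℕ → List Bool → List (ℕ × List Bool) → List (ℕ × List Bool)
grow k f [] = []
grow k f ((c , t) ∷ ts) =
  if (c <ᵇ k) ∧ not (meets f t)
  then (suc c , true ∷ t) ∷ (c , false ∷ t) ∷ grow k f ts
  else (c , false ∷ t) ∷ grow k f ts

candidates : ℕ → Pattern Bool → List (ℕ × List Bool)
candidates k []       = (0 , []) ∷ []
candidates k (f ∷ fs) = grow k f (candidates k fs)

either : List Bool → List Bool → List Bool
either (true  ∷ xs) (y ∷ ys) = true ∷ either xs ys
either (false ∷ xs) (y ∷ ys) = y ∷ either xs ys
either _            _        = []

-- Here `k` vertices remain to be chosen, `m` vertices remain to choose from, and `ex` marks those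
-- adjacent to a chosen one. A branch is cut as soon as too few vertices remain.
independent   : ℕ → ℕ → List Bool → Pattern Bool → List (List Bool)
independentAt : ℕ → ℕ → Bool → List Bool → List Bool → Pattern Bool → List (List Bool)
independent zero    m       ex       g       = map (λ _ → false) ex ∷ []
independent (suc k) (suc m) (e ∷ ex) (t ∷ g) = if m <ᵇ k then [] else independentAt k m e ex t g
independent (suc k) _       _        _       = []
independentAt k m true  ex t g = map (false ∷_) (independent (suc k) m ex g)
independentAt k m false ex t g =
  map (true ∷_) (independent k m (either ex t) g) ++ map (false ∷_) (independent (suc k) m ex g)

hitsAll : List (List Bool) → List Bool → Bool
hitsAll []       t = true
hitsAll (m ∷ ms) t = meets m t ∧ hitsAll ms t

sameBool : Bool → Bool → Bool
sameBool true  b = b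
sameBool false b = not b

weighBool : Bool → ℕ → ℕ → ℕ
weighBool true  s a = s + a
weighBool false s a = a

open Normalise weighBool sameBool public using () renaming (norm to normGraph; dedup to dedupGraphs)

-- A new vertex must be adjacent to a vertex of every obstacle.
module Chain (T : Test) (obstacles : Pattern Bool → List (List Bool)) where

  admissible : ℕ → List (List Bool) → List ℕ → ℕ → ℕ → List Bool → Bool
  admissible θ ms ds e c t = (θ ≤ᵇ c + e) ∧ (hitsAll ms t ∧ allAbove c (bumpBy t ds))

  keep : ℕ → List (List Bool) → Pattern Bool → List ℕ → ℕ → List (ℕ × List Bool) → List (ℕ × Pattern Bool)
  keep θ ms g ds e [] = []
  keep θ ms g ds e ((c , t) ∷ ts) =
    if admissible θ ms ds e c t
    then normGraph (c ∷ bumpBy t ds) (t ∷ g) ∷ keep θ ms g ds e ts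
    else keep θ ms g ds e ts

  extensions : ℕ → Pattern Bool → List (ℕ × Pattern Bool)
  extensions θ g =
    keep θ (obstacles g) g (degrees g) (edges g) (candidates (cap (length g) (degrees g)) (conflicts T g))

  step : ℕ → List (Pattern Bool) → List (Pattern Bool)
  step θ gs = dedupGraphs (concatMap (extensions θ) gs)

  run : List ℕ → List (Pattern Bool)
  run []       = [] ∷ []
  run (θ ∷ θs) = step θ (run θs)

-- Search for colourings

pattern R = zero
pattern G = suc zero
pattern B = suc (suc zero)

sameColour : Fin 3 → Fin 3 → Bool
sameColour R R = true
sameColour G G = true
sameColour B B = true
sameColour _ _ = false

weighColour : Fin 3 → ℕ → ℕ → ℕ
weighColour R s a = a
weighColour G s a = s + a
weighColour B s a = 10 * s + a

open Normalise weighColour sameColour public using () renaming (norm to normColouring; dedup to dedupColourings)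

layer : Fin 3 → Pattern (Fin 3) → Pattern Bool
layer c = map (map (sameColour c))

clash : Fin 3 → List Bool → List (Fin 3) → Bool
clash c (false ∷ fs) (x ∷ xs) = clash c fs xs
clash c (true  ∷ fs) (x ∷ xs) = sameColour c x ∨ clash c fs xs
clash c _            _        = false

Rows : Set
Rows = List (ℕ × List (Fin 3))

unless : Bool → ℕ × List (Fin 3) → Rows → Rows
unless true  t ts = ts
unless false t ts = t ∷ ts

growRed : ℕ → Bool → List Bool → ℕ → List (Fin 3) → Rows → Rows
growRed k false a j t ts = unless (clash R a t) (j , R ∷ t) ts
growRed k true  a j t ts = if j <ᵇ k then unless (clash R a t) (suc j , R ∷ t) ts else ts

growColours : ℕ → Bool → List Bool → List Bool → List Bool → Rows → Rows
growColours k m a b c [] = []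
growColours k m a b c ((j , t) ∷ ts) =
  growRed k m a j t (unless (clash G b t) (j , G ∷ t) (unless (clash B c t) (j , B ∷ t) (growColours k m a b c ts)))

-- The mask ms marks positions of which at most k may be red.
rows : ℕ → List Bool → Pattern Bool → Pattern Bool → Pattern Bool → Rows
rows k (m ∷ ms) (a ∷ as) (b ∷ bs) (c ∷ cs) = growColours k m a b c (rows k ms as bs cs)
rows k _ _ _ _ = (0 , []) ∷ []

rowsOf : ℕ → List Bool → Pattern (Fin 3) → Rows
rowsOf k ms g =
  rows k ms (conflicts path₃ (layer R g)) (conflicts path₄ (layer G g)) (conflicts path₄ (layer B g))

normal : Pattern (Fin 3) → ℕ × Pattern (Fin 3)
normal g = normColouring (map (λ _ → 1) g) g

attachAll : Pattern (Fin 3) → Rows → List (ℕ × Pattern (Fin 3))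
attachAll g ts = map (λ t → normal (proj₂ t ∷ g)) ts

attachFree : List Bool → Pattern (Fin 3) → List (ℕ × Pattern (Fin 3))
attachFree ms g = attachAll g (rowsOf 0 ms g)

extendBy : (Pattern (Fin 3) → List (ℕ × Pattern (Fin 3))) → List (Pattern (Fin 3)) → List (Pattern (Fin 3))
extendBy f gs = dedupColourings (concatMap f gs)

-- With limit 0, a mask that is true everywhere forbids red, and one that is false everywhere
-- forbids nothing.
redFreeExt anyExt : Pattern (Fin 3) → List (ℕ × Pattern (Fin 3))
redFreeExt g = attachFree (map (λ _ → true) g) g
anyExt g = attachFree (map (λ _ → false) g) g

noRed : List (Fin 3) → Bool
noRed []      = true
noRed (c ∷ t) = not (sameColour R c) ∧ noRed t

redFree : Pattern (Fin 3) → Bool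
redFree []      = true
redFree (t ∷ g) = noRed t ∧ redFree g

insertFalse : ℕ → List Bool → List Bool
insertFalse zero    xs       = false ∷ xs
insertFalse (suc k) []       = false ∷ []
insertFalse (suc k) (x ∷ xs) = x ∷ insertFalse k xs

-- Normalisation forgets which vertex was `w`, so every vertex whose deletion leaves a red-free
-- pattern is tried in its place. Once `x` is present, `hubs` recovers the candidates for `w` in the
-- same spirit.
splits : ℕ → ℕ → List (Fin 3) → Pattern (Fin 3) → List (ℕ × List (Fin 3))
splits zero    p t g = []
splits (suc m) p t g =
  if redFree (delete p t g) then (p , rowAt p t g) ∷ splits m (suc p) t g else splits m (suc p) t g

splitsOf : Pattern (Fin 3) → List (ℕ × List (Fin 3))
splitsOf []      = []
splitsOf (t ∷ g) = splits (suc (length g)) 0 t g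

-- Extends a red-free set with one further vertex w by a vertex having at most one red neighbour in common with w.
pairExt : Pattern (Fin 3) → List (ℕ × Pattern (Fin 3))
pairExt g = concatMap (λ s → attachAll g (rowsOf 1 (insertFalse (proj₁ s) (map (sameColour R) (proj₂ s))) g)) (splitsOf g)

common : List (Fin 3) → List (Fin 3) → ℕ
common (x ∷ xs) (y ∷ ys) = if sameColour R x ∧ sameColour R y then suc (common xs ys) else common xs ys
common _        _        = 0

closeTo : List (Fin 3) → List (ℕ × List (Fin 3)) → Bool
closeTo _        []             = false
closeTo []       _              = false
closeTo (x ∷ xs) ((q , w) ∷ qs) = (common (remove q x xs) w <ᵇ 2) ∨ closeTo (x ∷ xs) qs

hubs : ℕ → ℕ → List (Fin 3) → Pattern (Fin 3) → List ℕ
hubs zero    p t g = []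
hubs (suc m) p t g =
  if closeTo (rowAt p t g) (splitsOf (delete p t g)) then p ∷ hubs m (suc p) t g else hubs m (suc p) t g

hubsOf : Pattern (Fin 3) → List ℕ
hubsOf []      = []
hubsOf (t ∷ g) = hubs (suc (length g)) 0 t g

redAt : List (Fin 3) → List ℕ → Bool
redAt []       ps       = false
redAt (x ∷ xs) []       = false
redAt (x ∷ xs) (p ∷ ps) = sameColour R (select p x xs) ∨ redAt (x ∷ xs) ps

attachRed : List ℕ → Pattern (Fin 3) → Rows → List (ℕ × Pattern (Fin 3))
attachRed ps g [] = []
attachRed ps g ((_ , t) ∷ ts) =
  if redAt t ps then normal (t ∷ g) ∷ attachRed ps g ts else attachRed ps g ts

-- Extends a red-free set with two further vertices w, x as in pairExt by a vertex joined to w in red.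
hubExt : Pattern (Fin 3) → List (ℕ × Pattern (Fin 3))
hubExt g = attachRed (hubsOf g) g (rowsOf 0 (map (λ _ → false) g) g)

exchange : Fin 3 → Fin 3
exchange R = R
exchange G = B
exchange B = G

lighter : ℕ × Pattern (Fin 3) → ℕ × Pattern (Fin 3) → ℕ × Pattern (Fin 3)
lighter g h = if proj₁ h <ᵇ proj₁ g then h else g

-- C₆ is forbidden in green and in blue alike, so one of a pattern and its green-blue exchange
-- suffices. When the two keys differ, both patterns choose the same representative up to
-- relabelling.
upToExchange : Pattern (Fin 3) → ℕ × Pattern (Fin 3)
upToExchange g = lighter (normal g) (normal (map (map exchange) g))

repeated : ℕ → (List (Pattern (Fin 3)) → List (Pattern (Fin 3))) → List (Pattern (Fin 3)) → List (Pattern (Fin 3))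
repeated zero    f gs = gs
repeated (suc n) f gs = f (repeated n f gs)

-- Opaque, because otherwise the conversion checker evaluates these lists again and again.
opaque
  redFreeOf : ℕ → List (Pattern (Fin 3))
  redFreeOf n = repeated n (extendBy redFreeExt) ([] ∷ [])

-- Patterns of concrete vertex lists

Unique-resp-↭ : {xs ys : List A} → xs ↭ ys → Unique xs → Unique ys
Unique-resp-↭ p = Permₛ.Unique-resp-↭ (setoid _) (↭⇒↭ₛ p)

∨-true : ∀ a {b} → a ∨ b ≡ true → a ≡ true ⊎ b ≡ true
∨-true true  _ = inj₁ refl
∨-true false p = inj₂ p

∧-true : ∀ a {b} → a ∧ b ≡ true → a ≡ true × b ≡ true
∧-true true p = refl , p

T⇒≡ : ∀ {b} → T b → b ≡ true
T⇒≡ {true} _ = refl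

≡⇒T : ∀ {b} → b ≡ true → T b
≡⇒T refl = tt

select-remove : ∀ k (x : A) xs → x ∷ xs ↭ select k x xs ∷ remove k x xs
select-remove zero    x xs       = refl
select-remove (suc k) x []       = refl
select-remove (suc k) x (y ∷ ys) = trans (prep x (select-remove k y ys)) (swap x _ refl)

select-map : ∀ (f : A → C) k x xs → select k (f x) (map f xs) ≡ f (select k x xs)
select-map f zero    x xs       = refl
select-map f (suc k) x []       = refl
select-map f (suc k) x (y ∷ ys) = select-map f k y ys

remove-map : ∀ (f : A → C) k x xs → remove k (f x) (map f xs) ≡ map f (remove k x xs)
remove-map f zero    x xs       = refl
remove-map f (suc k) x []       = refl
remove-map f (suc k) x (y ∷ ys) = cong (f x ∷_) (remove-map f k y ys)

reorder-↭ : ∀ ks (xs : List A) → reorder ks xs ↭ xs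
reorder-↭ []       xs       = refl
reorder-↭ (k ∷ ks) []       = refl
reorder-↭ (k ∷ ks) (x ∷ xs) = trans (prep _ (reorder-↭ ks _)) (↭-sym (select-remove k x xs))

reorder-map : ∀ (f : A → C) ks xs → reorder ks (map f xs) ≡ map f (reorder ks xs)
reorder-map f []       xs       = refl
reorder-map f (k ∷ ks) []       = refl
reorder-map f (k ∷ ks) (x ∷ xs)
  rewrite remove-map f k x xs = cong₂ _∷_ (select-map f k x xs) (reorder-map f ks (remove k x xs))

pat : (V → V → C) → List V → Pattern C
pat c []       = []
pat c (v ∷ vs) = map (c v) vs ∷ pat c vs

length-pat : ∀ (c : V → V → C) vs → length (pat c vs) ≡ length vs
length-pat c []       = refl
length-pat c (v ∷ vs) = cong suc (length-pat c vs)

map-const : ∀ {C D : Set} (d : D) (c : V → V → C) vs → map (λ _ → d) (pat c vs) ≡ map (λ _ → d) vs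
map-const d c []       = refl
map-const d c (v ∷ vs) = cong (d ∷_) (map-const d c vs)

Sym : (V → V → C) → Set
Sym c = ∀ x y → c x y ≡ c y x

-- The entries for vertices before position `k` are read off the rows of those vertices, hence in
-- reversed direction; this is where symmetry enters.
rowAt-pat : (c : V → V → C) → Sym c → ∀ k v vs →
            rowAt k (map (c v) vs) (pat c vs) ≡ map (c (select k v vs)) (remove k v vs)
rowAt-pat c s zero    v vs       = refl
rowAt-pat c s (suc k) v []       = refl
rowAt-pat c s (suc k) v (w ∷ ws) =
  cong₂ _∷_ (≡-trans (select-map (c v) k w ws) (s v _)) (rowAt-pat c s k w ws)

delete-pat : (c : V → V → C) → ∀ k v vs →
             delete k (map (c v) vs) (pat c vs) ≡ pat c (remove k v vs)
delete-pat c zero    v vs       = refl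
delete-pat c (suc k) v []       = refl
delete-pat c (suc k) v (w ∷ ws) = cong₂ _∷_ (remove-map (c v) k w ws) (delete-pat c k w ws)

-- Correctness of the path tests

module Paths (E : V → V → Bool) (E-sym : Sym E) where

  private
    flip : ∀ {x y} → E x y ≡ true → E y x ≡ true
    flip p = ≡-trans (E-sym _ _) p

  -- The vertex found is reported through a permutation of `zs`. For the longer paths below this
  -- form makes the distinctness of all their vertices a consequence of the uniqueness of the list.
  meets-sound : ∀ (f h : V → Bool) zs → meets (map f zs) (map h zs) ≡ true →
                ∃₂ λ a rest → zs ↭ a ∷ rest × f a ≡ true × h a ≡ true
  meets-sound f h (z ∷ zs) p with f z in fz
  ... | true with h z in hz
  ...   | true = z , zs , refl , fz , hz
  ...   | false with meets-sound f h zs p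
  ...     | a , rest , q , fa , ha = a , z ∷ rest , trans (prep z q) (swap z a refl) , fa , ha
  meets-sound f h (z ∷ zs) p | false with meets-sound f h zs p
  ... | a , rest , q , fa , ha = a , z ∷ rest , trans (prep z q) (swap z a refl) , fa , ha

  Path₃ Path₄ : V → V → List V → Set
  Path₃ x y zs = ∃₂ λ a b → ∃ λ rest →
    zs ↭ a ∷ b ∷ rest × E x a ≡ true × E a b ≡ true × E b y ≡ true
  Path₄ x y zs = ∃₂ λ a b → ∃₂ λ d rest →
    zs ↭ a ∷ b ∷ d ∷ rest × E x a ≡ true × E a b ≡ true × E b d ≡ true × E d y ≡ true

  path₃-sound : ∀ x y zs → path₃ (map (E x) zs) (map (E y) zs) (pat E zs) ≡ true → Path₃ x y zs
  path₃-sound x y (z ∷ zs) p with ∨-true (E x z ∧ meets (map (E y) zs) (map (E z) zs)) p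
  ... | inj₁ q with ∧-true (E x z) q
  ...   | xz , m with meets-sound (E y) (E z) zs m
  ...     | b , rest , r , yb , zb = z , b , rest , prep z r , xz , zb , flip yb
  path₃-sound x y (z ∷ zs) p | inj₂ q with ∨-true (E y z ∧ meets (map (E x) zs) (map (E z) zs)) q
  ... | inj₁ q′ with ∧-true (E y z) q′
  ...   | yz , m with meets-sound (E x) (E z) zs m
  ...     | a , rest , r , xa , za =
            a , z , rest , trans (prep z r) (swap z a refl) , xa , flip za , flip yz
  path₃-sound x y (z ∷ zs) p | inj₂ q | inj₂ q′ with path₃-sound x y zs q′
  ... | a , b , rest , r , e =
        a , b , z ∷ rest , trans (prep z r) (↭-sym (shift z (a ∷ b ∷ []) rest)) , e

  fork-sound : ∀ x y b zs → fork (map (E x) zs) (map (E y) zs) (map (E b) zs) ≡ true →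
               ∃₂ λ a d → ∃ λ rest →
               zs ↭ a ∷ d ∷ rest × E x a ≡ true × E a b ≡ true × E b d ≡ true × E d y ≡ true
  fork-sound x y b (z ∷ zs) p with E b z in bz
  ... | false with fork-sound x y b zs p
  ...   | a , d , rest , r , e =
          a , d , z ∷ rest , trans (prep z r) (↭-sym (shift z (a ∷ d ∷ []) rest)) , e
  fork-sound x y b (z ∷ zs) p | true with ∨-true (E x z ∧ meets (map (E y) zs) (map (E b) zs)) p
  ... | inj₁ q with ∧-true (E x z) q
  ...   | xz , m with meets-sound (E y) (E b) zs m
  ...     | d , rest , r , yd , bd = z , d , rest , prep z r , xz , flip bz , bd , flip yd
  fork-sound x y b (z ∷ zs) p | true | inj₂ q with ∨-true (E y z ∧ meets (map (E x) zs) (map (E b) zs)) q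
  ... | inj₁ q′ with ∧-true (E y z) q′
  ...   | yz , m with meets-sound (E x) (E b) zs m
  ...     | a , rest , r , xa , ba =
            a , z , rest , trans (prep z r) (swap z a refl) , xa , flip ba , bz , flip yz
  fork-sound x y b (z ∷ zs) p | true | inj₂ q | inj₂ q′ with fork-sound x y b zs q′
  ... | a , d , rest , r , e =
        a , d , z ∷ rest , trans (prep z r) (↭-sym (shift z (a ∷ d ∷ []) rest)) , e

  path₄-sound : ∀ x y zs → path₄ (map (E x) zs) (map (E y) zs) (pat E zs) ≡ true → Path₄ x y zs
  path₄-sound x y (z ∷ zs) p with ∨-true (E x z ∧ path₃ (map (E z) zs) (map (E y) zs) (pat E zs)) p
  ... | inj₁ q with ∧-true (E x z) q
  ...   | xz , m with path₃-sound z y zs m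
  ...     | b , d , rest , r , zb , bd , dy = z , b , d , rest , prep z r , xz , zb , bd , dy
  path₄-sound x y (z ∷ zs) p | inj₂ q with ∨-true (E y z ∧ path₃ (map (E x) zs) (map (E z) zs) (pat E zs)) q
  ... | inj₁ q′ with ∧-true (E y z) q′
  ...   | yz , m with path₃-sound x z zs m
  ...     | a , b , rest , r , xa , ab , bz =
            a , b , z , rest , trans (prep z r) (↭-sym (shift z (a ∷ b ∷ []) rest)) , xa , ab , bz , flip yz
  path₄-sound x y (z ∷ zs) p | inj₂ q | inj₂ q′ with ∨-true (fork (map (E x) zs) (map (E y) zs) (map (E z) zs)) q′
  ... | inj₁ f with fork-sound x y z zs f
  ...   | a , d , rest , r , xa , az , zd , dy =
          a , z , d , rest , trans (prep z r) (swap z a refl) , xa , az , zd , dy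
  path₄-sound x y (z ∷ zs) p | inj₂ q | inj₂ q′ | inj₂ q″ with path₄-sound x y zs q″
  ... | a , b , d , rest , r , e =
        a , b , d , z ∷ rest , trans (prep z r) (↭-sym (shift z (a ∷ b ∷ d ∷ []) rest)) , e

-- Correctness of the conflicts

-- The row of a new vertex respects all conflicts.
data Clean : Pattern Bool → List Bool → Set where
  []  : Clean [] []
  _∷_ : ∀ {f fs b t} → (b ≡ true → meets f t ≡ false) → Clean fs t → Clean (f ∷ fs) (b ∷ t)

drop-select : ∀ i (x : A) xs → (drop i (x ∷ xs) ≡ []) ⊎ (drop i (x ∷ xs) ≡ select i x xs ∷ drop (suc i) (x ∷ xs))
drop-select zero    x xs       = inj₂ refl
drop-select (suc i) x []       = inj₁ (drop-[] i)
  where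
  drop-[] : ∀ i → drop i [] ≡ ([] {A = _})
  drop-[] zero    = refl
  drop-[] (suc _) = refl
drop-select (suc i) x (y ∷ ys) = drop-select i y ys

drop-select-≤ : ∀ i (x : A) xs → i ≤ length xs → drop i (x ∷ xs) ≡ select i x xs ∷ drop i xs
drop-select-≤ zero    x xs       _       = refl
drop-select-≤ (suc i) x (y ∷ ys) (s≤s p) = drop-select-≤ i y ys p

drop-remove : ∀ i (x : A) xs → drop i xs ≡ drop i (remove i x xs)
drop-remove zero    x xs       = refl
drop-remove (suc i) x []       = refl
drop-remove (suc i) x (y ∷ ys) = drop-remove i y ys

-- Here `v` is the vertex to be added: its edges to `x` and `y` together with the path that `T`
-- detects through `zs` form the forbidden cycle.
NoClosing : Test → (V → V → Bool) → Set
NoClosing T E = ∀ v x y zs → Unique (v ∷ x ∷ y ∷ zs) → E v x ≡ true → E v y ≡ true →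
                T (map (E x) zs) (map (E y) zs) (pat E zs) ≡ true → ⊥

module Conflicts (T : Test) (E : V → V → Bool) (E-sym : Sym E) (open-ended : NoClosing T E) where

  conflictsFrom-sound : ∀ v x i m us → Unique (v ∷ x ∷ us) → E v x ≡ true →
    meets (conflictsFrom T i m (map (E x) us) (pat E us)) (map (E v) (drop i us)) ≡ true → ⊥
  conflictsFrom-sound v x i zero    []       u vx ()
  conflictsFrom-sound v x i zero    (_ ∷ _)  u vx ()
  conflictsFrom-sound v x i (suc m) []       u vx ()
  conflictsFrom-sound v x i (suc m) (w ∷ ws) u vx p
    with T (remove i (E x w) (map (E x) ws)) (rowAt i (map (E w) ws) (pat E ws)) (delete i (map (E w) ws) (pat E ws)) in eq
       | drop i (w ∷ ws) | drop-select i w ws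
  conflictsFrom-sound v x i (suc m) (w ∷ ws) u vx () | true  | _ | inj₁ refl
  conflictsFrom-sound v x i (suc m) (w ∷ ws) u vx () | false | _ | inj₁ refl
  ... | false | _ | inj₂ refl = conflictsFrom-sound v x (suc i) m (w ∷ ws) u vx p
  ... | true  | _ | inj₂ refl with ∨-true (E v (select i w ws)) p
  ...   | inj₂ q = conflictsFrom-sound v x (suc i) m (w ∷ ws) u vx q
  ...   | inj₁ vy
    rewrite remove-map (E x) i w ws | rowAt-pat E E-sym i w ws | delete-pat E i w ws =
    open-ended v x (select i w ws) (remove i w ws)
       (Unique-resp-↭ (prep v (prep x (select-remove i w ws))) u) vx vy eq

  conflictRows-clean : ∀ v i m w ws → Unique (v ∷ w ∷ ws) → i + m ≡ length ws →
    Clean (conflictRows T i m (map (E w) ws) (pat E ws)) (map (E v) (drop i (w ∷ ws)))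
  conflictRows-clean v i zero w ws u eq = last i w ws (≡-trans (sym (+-identityʳ i)) eq)
    where
    last : ∀ i w ws → i ≡ length ws → Clean ([] ∷ []) (map (E v) (drop i (w ∷ ws)))
    last .0 w [] refl = (λ _ → refl) ∷ []
    last (suc i) w (x ∷ xs) eq = last i x xs (suc-injective eq)
  conflictRows-clean v i (suc m) w ws u eq
    rewrite drop-select-≤ i w ws (subst (i ≤_) eq (m≤m+n i (suc m))) =
    row ∷ conflictRows-clean v (suc i) m w ws u (≡-trans (sym (+-suc i m)) eq)
    where
    row : E v (select i w ws) ≡ true →
      meets (conflictsFrom T i (suc m) (rowAt i (map (E w) ws) (pat E ws)) (delete i (map (E w) ws) (pat E ws)))
            (map (E v) (drop i ws)) ≡ false
    row vx rewrite rowAt-pat E E-sym i w ws | delete-pat E i w ws | drop-remove i w ws =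
      ¬-not (conflictsFrom-sound v (select i w ws) i (suc m) (remove i w ws)
        (Unique-resp-↭ (prep v (select-remove i w ws)) u) vx)

  conflicts-clean : ∀ v vs → Unique (v ∷ vs) → Clean (conflicts T (pat E vs)) (map (E v) vs)
  conflicts-clean v []       u = []
  conflicts-clean v (w ∷ ws) u rewrite length-pat E ws = conflictRows-clean v 0 (length ws) w ws u refl

-- Correctness of normal forms and of the removal of duplicates

module NormaliseSound {C : Set} (weigh : C → ℕ → ℕ → ℕ) (same : C → C → Bool)
                      (same-sound : ∀ x y → same x y ≡ true → x ≡ y) where

  open Normalise weigh same

  module _ {V : Set} (c : V → V → C) (c-sym : Sym c) where

    sort-pat : ∀ f K cs vs →
      proj₂ (sort f K cs (pat c vs)) ≡ pat c (reorder (proj₁ (sort f K cs (pat c vs))) vs)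
    -- The row and the remaining pattern are variables constrained by equations, so that matching on
    -- `refl` replaces `rowAt` and `delete` by their meaning.
    attachTo-pat : ∀ f K k cs {r g} s vs → r ≡ map (c s) vs → g ≡ pat c vs →
      proj₂ (attachTo f K k cs r g) ≡
      pat c (s ∷ reorder (proj₁ (sort f (5 * K) (bump K r cs) g)) vs)
    sort-pat zero    K cs       vs       = refl
    sort-pat (suc f) K []       vs       = refl
    sort-pat (suc f) K (x ∷ xs) []       = refl
    sort-pat (suc f) K (x ∷ xs) (v ∷ vs) =
      attachTo-pat f K k (remove k x xs) (select k v vs) (remove k v vs)
        (rowAt-pat c c-sym k v vs) (delete-pat c k v vs)
      where k = argmax x 0 1 xs
    attachTo-pat f K k cs s vs refl refl =
      cong₂ _∷_ (reorder-map (c s) _ vs) (sort-pat f (5 * K) (bump K (map (c s) vs) cs) vs)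

    norm-pat : ∀ cs vs → ∃ λ vs′ → vs′ ↭ vs × proj₂ (norm cs (pat c vs)) ≡ pat c vs′
    norm-pat cs vs = reorder ks vs , reorder-↭ ks vs , sort-pat (length g) 104729 cs′ vs
      where
      g   = pat c vs
      cs′ = refine g (refine g cs)
      ks  = proj₁ (sort (length g) 104729 cs′ g)

  sameRow-sound : ∀ s t → sameRow s t ≡ true → s ≡ t
  sameRow-sound []       []       _ = refl
  sameRow-sound (x ∷ xs) (y ∷ ys) p with ∧-true (same x y) p
  ... | q , r = cong₂ _∷_ (same-sound x y q) (sameRow-sound xs ys r)

  samePattern-sound : ∀ g h → samePattern g h ≡ true → g ≡ h
  samePattern-sound []      []      _ = refl
  samePattern-sound (s ∷ g) (t ∷ h) p with ∧-true (sameRow s t) p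
  ... | q , r = cong₂ _∷_ (sameRow-sound s t q) (samePattern-sound g h r)

  member-sound : ∀ g hs → member g hs ≡ true → g ∈ hs
  member-sound g (h ∷ hs) p with ∨-true (samePattern g h) p
  ... | inj₁ q = here (samePattern-sound g h q)
  ... | inj₂ q = there (member-sound g hs q)

  ∈-insert : ∀ k g t → g ∈ toList (insert k g t)
  ∈-insert k g leaf = here refl
  ∈-insert k g (node l j hs r) with k <ᵇ j | j <ᵇ k | member g hs in eq
  ... | true  | _     | _     = ∈-++⁺ˡ (∈-insert k g l)
  ... | false | true  | _     = ∈-++⁺ʳ (toList l) (∈-++⁺ʳ hs (∈-insert k g r))
  ... | false | false | true  = ∈-++⁺ʳ (toList l) (∈-++⁺ˡ (member-sound g hs eq))
  ... | false | false | false = ∈-++⁺ʳ (toList l) (here refl)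

  -- Completeness only requires that no pattern gets lost: one is left out solely when an identical
  -- one already lies in the same node.
  insert-⊇ : ∀ k g {h} t → h ∈ toList t → h ∈ toList (insert k g t)
  insert-⊇ k g (node l j hs r) p with k <ᵇ j | j <ᵇ k | member g hs | ∈-++⁻ (toList l) p
  ... | true  | _     | _     | inj₁ q = ∈-++⁺ˡ (insert-⊇ k g l q)
  ... | true  | _     | _     | inj₂ q = ∈-++⁺ʳ (toList (insert k g l)) q
  ... | false | true  | _     | inj₁ q = ∈-++⁺ˡ q
  ... | false | false | true  | _      = p
  ... | false | false | false | inj₁ q = ∈-++⁺ˡ q
  ... | false | false | false | inj₂ q = ∈-++⁺ʳ (toList l) (there q)
  ... | false | true  | _     | inj₂ q with ∈-++⁻ hs q
  ...   | inj₁ q′ = ∈-++⁺ʳ (toList l) (∈-++⁺ˡ q′)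
  ...   | inj₂ q′ = ∈-++⁺ʳ (toList l) (∈-++⁺ʳ hs (insert-⊇ k g r q′))

  ∈-dedup : ∀ {p} ps → p ∈ ps → proj₂ p ∈ dedup ps
  ∈-dedup ((k , g) ∷ ps) (here refl) = ∈-insert k g (collect ps)
  ∈-dedup ((k , g) ∷ ps) (there q)   = insert-⊇ k g (collect ps) (∈-dedup ps q)

sameBool-sound : ∀ x y → sameBool x y ≡ true → x ≡ y
sameBool-sound true  true  _ = refl
sameBool-sound false false _ = refl

open NormaliseSound weighBool sameBool sameBool-sound public
  using () renaming (norm-pat to normGraph-pat; ∈-dedup to ∈-dedupGraphs)

-- Completeness of the edge search

<ᵇ-true : ∀ {m n} → m < n → (m <ᵇ n) ≡ true
<ᵇ-true p = T⇒≡ (<⇒<ᵇ p)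

≤ᵇ-true : ∀ {m n} → m ≤ n → (m ≤ᵇ n) ≡ true
≤ᵇ-true p = T⇒≡ (≤⇒≤ᵇ p)

grow-false : ∀ k f {c t} ts → (c , t) ∈ ts → (c , false ∷ t) ∈ grow k f ts
grow-false k f ((c , t) ∷ ts) p with (c <ᵇ k) ∧ not (meets f t) | p
... | true  | here refl = there (here refl)
... | false | here refl = here refl
... | true  | there q   = there (there (grow-false k f ts q))
... | false | there q   = there (grow-false k f ts q)

grow-true : ∀ k f {c t} ts → (c , t) ∈ ts → c < k → meets f t ≡ false → (suc c , true ∷ t) ∈ grow k f ts
grow-true k f ((c , t) ∷ ts) (here refl) c<k m rewrite <ᵇ-true c<k | m = here refl
grow-true k f ((c , t) ∷ ts) (there q)   c<k m with (c <ᵇ k) ∧ not (meets f t)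
... | true  = there (there (grow-true k f ts q c<k m))
... | false = there (grow-true k f ts q c<k m)

candidates-complete : ∀ {k fs t} → Clean fs t → count t ≤ k → (count t , t) ∈ candidates k fs
candidates-complete [] p = here refl
candidates-complete {k} {f ∷ fs} {true  ∷ t} (ok ∷ cl) p =
  grow-true k f _ (candidates-complete cl (≤-trans (n≤1+n _) p)) p (ok refl)
candidates-complete {k} {f ∷ fs} {false ∷ t} (ok ∷ cl) p = grow-false k f _ (candidates-complete cl p)

count-↭ : ∀ (f : V → Bool) {xs ys} → xs ↭ ys → count (map f xs) ≡ count (map f ys)
count-↭ f refl = refl
count-↭ f (prep x p) with f x
... | true  = cong suc (count-↭ f p)
... | false = count-↭ f p
count-↭ f (swap x y p) with f x | f y
... | true  | true  = cong (λ n → suc (suc n)) (count-↭ f p)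
... | true  | false = cong suc (count-↭ f p)
... | false | true  = cong suc (count-↭ f p)
... | false | false = count-↭ f p
count-↭ f (trans p q) = ≡-trans (count-↭ f p) (count-↭ f q)

bit : Bool → ℕ
bit true  = 1
bit false = 0

count-∷ : ∀ b t → count (b ∷ t) ≡ bit b + count t
count-∷ true  t = refl
count-∷ false t = refl

count≤length : ∀ t → count t ≤ length t
count≤length []          = z≤n
count≤length (true ∷ t)  = s≤s (count≤length t)
count≤length (false ∷ t) = m≤n⇒m≤1+n (count≤length t)

+-exchange : ∀ a b c → a + (b + c) ≡ b + (a + c)
+-exchange a b c = ≡-trans (sym (+-assoc a b c)) (≡-trans (cong (_+ c) (+-comm a b)) (+-assoc b a c))

module Degrees (E : V → V → Bool) (E-sym : Sym E) (E-irr : ∀ x → E x x ≡ false) where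

  deg : List V → V → ℕ
  deg vs v = count (map (E v) vs)

  bumpBy-map : ∀ v us (d : V → ℕ) → bumpBy (map (E v) us) (map d us) ≡ map (λ u → bit (E u v) + d u) us
  bumpBy-map v []       d = refl
  bumpBy-map v (u ∷ us) d rewrite E-sym u v with E v u
  ... | true  = cong (_ ∷_) (bumpBy-map v us d)
  ... | false = cong (_ ∷_) (bumpBy-map v us d)

  deg-self : ∀ v vs → deg (v ∷ vs) v ≡ deg vs v
  deg-self v vs rewrite E-irr v = refl

  degrees-tail : ∀ v vs → degrees (pat E vs) ≡ map (deg vs) vs →
                 bumpBy (map (E v) vs) (degrees (pat E vs)) ≡ map (deg (v ∷ vs)) vs
  degrees-tail v vs ih rewrite ih =
    ≡-trans (bumpBy-map v vs (deg vs)) (map-cong (λ u → sym (count-∷ (E u v) (map (E u) vs))) vs)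

  degrees-pat : ∀ vs → degrees (pat E vs) ≡ map (deg vs) vs
  degrees-pat []       = refl
  degrees-pat (v ∷ vs) = cong₂ _∷_ (sym (deg-self v vs)) (degrees-tail v vs (degrees-pat vs))

  edges-↭ : ∀ {xs ys} → xs ↭ ys → edges (pat E xs) ≡ edges (pat E ys)
  edges-↭ refl = refl
  edges-↭ (prep x p) = cong₂ _+_ (count-↭ (E x) p) (edges-↭ p)
  edges-↭ (swap {xs} {ys} x y p)
    rewrite count-∷ (E x y) (map (E x) xs) | count-∷ (E y x) (map (E y) ys) | E-sym x y
          | count-↭ (E x) p | count-↭ (E y) p | edges-↭ p =
    lemma (bit (E y x)) (count (map (E x) ys)) (count (map (E y) ys)) (edges (pat E ys))
    where
    open import Data.Nat.Solver using (module +-*-Solver)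
    open +-*-Solver
    lemma : ∀ a b c d → a + b + (c + d) ≡ a + c + (b + d)
    lemma = solve 4 (λ a b c d → a :+ b :+ (c :+ d) := a :+ c :+ (b :+ d)) refl
  edges-↭ (trans p q) = ≡-trans (edges-↭ p) (edges-↭ q)

  total : List ℕ → ℕ
  total []       = 0
  total (x ∷ xs) = x + total xs

  total-bumpBy : ∀ v (d : V → ℕ) us → total (bumpBy (map (E v) us) (map d us)) ≡ count (map (E v) us) + total (map d us)
  total-bumpBy v d [] = refl
  total-bumpBy v d (u ∷ us) with E v u
  ... | true  = cong suc (≡-trans (cong (d u +_) (total-bumpBy v d us)) (+-exchange (d u) (count (map (E v) us)) _))
  ... | false = ≡-trans (cong (d u +_) (total-bumpBy v d us)) (+-exchange (d u) (count (map (E v) us)) _)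

  handshake : ∀ vs → total (map (deg vs) vs) ≡ edges (pat E vs) + edges (pat E vs)
  handshake [] = refl
  handshake (v ∷ vs)
    rewrite deg-self v vs | sym (degrees-tail v vs (degrees-pat vs)) | degrees-pat vs
          | total-bumpBy v (deg vs) vs | handshake vs =
    lemma (count (map (E v) vs)) (edges (pat E vs))
    where
    open import Data.Nat.Solver using (module +-*-Solver)
    open +-*-Solver
    lemma : ∀ a e → a + (a + (e + e)) ≡ a + e + (a + e)
    lemma = solve 2 (λ a e → a :+ (a :+ (e :+ e)) := a :+ e :+ (a :+ e)) refl

  deg-↭ : ∀ {xs ys} v → xs ↭ ys → deg xs v ≡ deg ys v
  deg-↭ v = count-↭ (E v)

  minimum : ∀ (d : V → ℕ) v vs → ∃₂ λ u us → v ∷ vs ↭ u ∷ us × All (λ w → d u ≤ d w) us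
  minimum d v [] = v , [] , refl , []
  minimum d v (w ∷ ws) with minimum d w ws
  ... | u , us , p , least with ≤-total (d v) (d u)
  ...   | inj₁ v≤u = v , u ∷ us , prep v p , v≤u ∷ weaken least
    where
    weaken : ∀ {xs} → All (λ w → d u ≤ d w) xs → All (λ w → d v ≤ d w) xs
    weaken []       = []
    weaken (x ∷ xs) = ≤-trans v≤u x ∷ weaken xs
  ...   | inj₂ u≤v = u , v ∷ us , trans (prep v p) (swap v u refl) , u≤v ∷ least

  total-≥ : ∀ (d : V → ℕ) m us → All (λ w → m ≤ d w) us → length us * m ≤ total (map d us)
  total-≥ d m []       []       = z≤n
  total-≥ d m (u ∷ us) (p ∷ ps) = +-mono-≤ p (total-≥ d m us ps)

-- drops θ θ′ n: deleting a vertex of minimum degree from a graph with n + 1 vertices and at least θ′ edges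
-- leaves at least θ edges, by averaging.
drops : ℕ → ℕ → ℕ → Bool
drops zero    θ′ n = true
drops (suc θ) θ′ n = suc n * θ <ᵇ (n ∸ 1) * θ′

threshold : List ℕ → ℕ
threshold []      = 0
threshold (θ ∷ _) = θ

valid : List ℕ → Bool
valid []       = true
valid (θ ∷ θs) = drops (threshold θs) θ (length θs) ∧ valid θs

-- Here `d` is the minimum degree and `e` the number of edges left after the deletion. If `e` were
-- at most `θ`, expanding $(n+1)(d+e)$ and using the handshake bound $(n+1)d ≤ 2(d+e)$ would give
-- $(n-1)(d+e) ≤ (n+1)θ$, against `drops`.
drops-sound : ∀ θ θ′ n d e → drops θ θ′ n ≡ true → θ′ ≤ d + e → suc n * d ≤ (d + e) + (d + e) → θ ≤ e
drops-sound zero    θ′ n       d e ok lo hi = z≤n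
drops-sound (suc θ) θ′ (suc k) d e ok lo hi with suc θ ≤? e
... | yes p = p
... | no ¬p = ⊥-elim (<-irrefl refl (<-≤-trans (<ᵇ⇒< _ _ (≡⇒T ok)) (≤-trans (*-monoʳ-≤ k lo) key)))
  where
  e≤θ : e ≤ θ
  e≤θ = ≤-pred (≰⇒> ¬p)
  split : suc (suc k) * (d + e) ≡ (d + e) + (d + e) + k * (d + e)
  split = sym (+-assoc (d + e) (d + e) (k * (d + e)))
  key : k * (d + e) ≤ suc (suc k) * θ
  key = +-cancelˡ-≤ ((d + e) + (d + e)) _ _ (begin
    (d + e) + (d + e) + k * (d + e)        ≡⟨ sym split ⟩
    suc (suc k) * (d + e)                  ≡⟨ *-distribˡ-+ (suc (suc k)) d e ⟩
    suc (suc k) * d + suc (suc k) * e      ≤⟨ +-mono-≤ hi (*-monoʳ-≤ (suc (suc k)) e≤θ) ⟩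
    (d + e) + (d + e) + suc (suc k) * θ    ∎)
    where open ≤-Reasoning

allAbove-complete : ∀ {d xs} → All (d ≤_) xs → allAbove d xs ≡ true
allAbove-complete []       = refl
allAbove-complete (p ∷ ps) rewrite ≤ᵇ-true p = allAbove-complete ps

cap-complete : ∀ {c m ds} → c ≤ m → All (λ d → c ≤ suc d) ds → c ≤ cap m ds
cap-complete p []       = p
cap-complete p (q ∷ qs) = ⊓-glb q (cap-complete p qs)

bit-≤ : ∀ b n → bit b + n ≤ suc n
bit-≤ true  n = ≤-refl
bit-≤ false n = n≤1+n n

tail-unique : ∀ {A : Set} {x : A} {xs} → Unique (x ∷ xs) → Unique xs
tail-unique (_ ∷ u) = u

module ChainSound
  (T : Test) (obstacles : Pattern Bool → List (List Bool))
  (E : V → V → Bool) (E-sym : Sym E) (E-irr : ∀ x → E x x ≡ false)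
  (no-closing : NoClosing T E)
  (hits : ∀ v vs → Unique (v ∷ vs) → hitsAll (obstacles (pat E vs)) (map (E v) vs) ≡ true)
  where

  open Chain T obstacles
  open Degrees E E-sym E-irr
  open Conflicts T E E-sym no-closing

  Listed : List (Pattern Bool) → List V → Set
  Listed gs vs = ∃ λ vs′ → vs′ ↭ vs × pat E vs′ ∈ gs

  keep-complete : ∀ θ ms g ds e {c t} ts → (c , t) ∈ ts → admissible θ ms ds e c t ≡ true →
                  normGraph (c ∷ bumpBy t ds) (t ∷ g) ∈ keep θ ms g ds e ts
  keep-complete θ ms g ds e ((c , t) ∷ ts) (here refl) ok rewrite ok = here refl
  keep-complete θ ms g ds e ((c , t) ∷ ts) (there p)   ok with admissible θ ms ds e c t
  ... | true  = there (keep-complete θ ms g ds e ts p ok)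
  ... | false = keep-complete θ ms g ds e ts p ok

  step-complete : ∀ θ gs u us → Unique (u ∷ us) → θ ≤ edges (pat E (u ∷ us)) →
                  All (λ w → deg us u ≤ deg (u ∷ us) w) us → pat E us ∈ gs → Listed (step θ gs) (u ∷ us)
  step-complete θ gs u us uniq θ≤e least g∈ =
    vs′ , vs′↭ , subst (_∈ step θ gs) eq (∈-dedupGraphs _ (∈-concatMap⁺ (extensions θ) (Any.map (λ { refl → in-ext }) g∈)))
    where
    g = pat E us
    t = map (E u) us
    normal-form = normGraph-pat E E-sym (count t ∷ bumpBy t (degrees g)) (u ∷ us)
    vs′ = proj₁ normal-form
    vs′↭ = proj₁ (proj₂ normal-form)
    eq = proj₂ (proj₂ normal-form)
    within : count t ≤ cap (length g) (degrees g)
    within rewrite degrees-pat us | length-pat E us =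
      cap-complete (subst (count t ≤_) (length-map (E u) us) (count≤length t))
        (map⁺ (All.map (λ {w} p → ≤-trans (subst (count t ≤_) (count-∷ (E w u) (map (E w) us)) p) (bit-≤ (E w u) _)) least))
    fine : admissible θ (obstacles g) (degrees g) (edges g) (count t) t ≡ true
    fine rewrite ≤ᵇ-true θ≤e | hits u us uniq | degrees-tail u us (degrees-pat us) =
      allAbove-complete (map⁺ least)
    in-ext : normGraph (count t ∷ bumpBy t (degrees g)) (t ∷ g) ∈ extensions θ g
    in-ext = keep-complete θ (obstacles g) g (degrees g) (edges g) _
               (candidates-complete (conflicts-clean u us uniq) within) fine

  -- Induction by deleting a vertex `u` of minimum degree: by averaging the rest still meets its
  -- threshold. The search knows only some permutation `us′` of the rest, and `u` is added to that;
  -- degrees and edge counts do not change under permutation.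
  run-complete : ∀ θs → valid θs ≡ true → ∀ vs → Unique vs → length vs ≡ length θs →
                 threshold θs ≤ edges (pat E vs) → Listed (run θs) vs
  run-complete []       ok []       uniq len θ≤e = [] , refl , here refl
  run-complete (θ ∷ θs) ok (v ∷ vs) uniq len θ≤e
    with ∧-true (drops (threshold θs) θ (length θs)) ok | minimum (deg (v ∷ vs)) v vs
  ... | okθ , oks | u , us , p , least = conclude (run-complete θs oks us us-unique us-length θ≤us)
    where
    ws-unique : Unique (u ∷ us)
    ws-unique = Unique-resp-↭ p uniq
    us-unique = tail-unique ws-unique
    us-length : length us ≡ length θs
    us-length = suc-injective (≡-trans (sym (↭-length p)) len)
    least′ : All (λ w → deg us u ≤ deg (u ∷ us) w) us
    least′ = All.map (λ {w} q → subst (deg us u ≤_) (deg-↭ w p)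
                                 (subst (_≤ deg (v ∷ vs) w) (≡-trans (deg-↭ u p) (deg-self u us)) q)) least
    θ≤ws : θ ≤ deg us u + edges (pat E us)
    θ≤ws = subst (θ ≤_) (edges-↭ p) θ≤e
    many : suc (length θs) * deg us u ≤ edges (pat E (u ∷ us)) + edges (pat E (u ∷ us))
    many = subst (λ n → suc n * deg us u ≤ _) us-length
             (subst (suc (length us) * deg us u ≤_) (handshake (u ∷ us))
               (total-≥ (deg (u ∷ us)) (deg us u) (u ∷ us) (≤-reflexive (sym (deg-self u us)) ∷ least′)))
    θ≤us : threshold θs ≤ edges (pat E us)
    θ≤us = drops-sound (threshold θs) θ (length θs) (deg us u) _ okθ θ≤ws many
    conclude : Listed (run θs) us → Listed (step θ (run θs)) (v ∷ vs)
    conclude (us′ , q , g∈)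
      with step-complete θ (run θs) u us′ (Unique-resp-↭ (prep u (↭-sym q)) ws-unique)
             (subst (θ ≤_) (≡-trans (edges-↭ p) (edges-↭ (prep u (↭-sym q)))) θ≤e)
             (All.map (λ {w} r → subst (deg us′ u ≤_) (deg-↭ w (prep u (↭-sym q)))
                                   (subst (_≤ deg (u ∷ us) w) (deg-↭ u (↭-sym q)) r))
                      (All-resp-↭ (↭-sym q) least′))
             g∈
    ... | vs′ , r , h∈ = vs′ , trans r (trans (prep u q) (↭-sym p)) , h∈

  few-edges : ∀ θs → valid θs ≡ true → run θs ≡ [] → ∀ vs → Unique vs → length vs ≡ length θs →
              edges (pat E vs) < threshold θs
  few-edges θs ok empty vs uniq len with threshold θs ≤? edges (pat E vs)
  ... | no ¬p = ≰⇒> ¬p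
  ... | yes p with run-complete θs ok vs uniq len p
  ...   | vs′ , _ , g∈ with subst (pat E vs′ ∈_) empty g∈
  ...     | ()

-- Independent sets as obstacles

∨-false : ∀ a {b} → a ∨ b ≡ false → a ≡ false × b ≡ false
∨-false false p = refl , p

independents : ℕ → Pattern Bool → List (List Bool)
independents k g = independent k (length g) (map (λ _ → false) g) g

module Independence (E : V → V → Bool) where

  Independent : List V → Set
  Independent = AllPairs (λ x y → E x y ≡ false)

  -- Ties a mask to the vertex set it encodes. The field `marked` says how the encoding is used: a
  -- row that misses the mask is false on the whole set.
  record Marks (k : ℕ) (zs : List V) (f : V → Bool) (mask : List Bool) : Set where
    field
      set      : List V
      size     : length set ≡ k
      distinct : Unique set
      inside   : All (_∈ zs) set
      indep    : Independent set
      allowed  : All (λ x → f x ≡ false) set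
      marked   : ∀ h → meets mask (map h zs) ≡ false → All (λ x → h x ≡ false) set
  open Marks

  either-map : ∀ (f h : V → Bool) zs → either (map f zs) (map h zs) ≡ map (λ x → f x ∨ h x) zs
  either-map f h [] = refl
  either-map f h (z ∷ zs) with f z
  ... | true  = cong (true ∷_) (either-map f h zs)
  ... | false = cong (h z ∷_) (either-map f h zs)

  skip : ∀ {k z zs f mask} → Marks k zs f mask → Marks k (z ∷ zs) f (false ∷ mask)
  skip m = record
    { set = set m ; size = size m ; distinct = distinct m ; inside = All.map there (inside m)
    ; indep = indep m ; allowed = allowed m ; marked = λ h p → marked m h p }

  -- The excluded vertices now include the neighbours of `z`, so `allowed` for the rest yields both
  -- the old exclusion and the independence from `z`.
  take : ∀ {k z zs f mask} → f z ≡ false → Unique (z ∷ zs) →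
         Marks k zs (λ x → f x ∨ E z x) mask → Marks (suc k) (z ∷ zs) f (true ∷ mask)
  take {z = z} {f = f} fz (z∉ ∷ u) m = record
    { set = z ∷ set m
    ; size = cong suc (size m)
    ; distinct = All.map (λ x∈ → All.lookup z∉ x∈) (inside m) ∷ distinct m
    ; inside = here refl ∷ All.map there (inside m)
    ; indep = All.map (λ {x} p → proj₂ (∨-false (f x) p)) (allowed m) ∷ indep m
    ; allowed = fz ∷ All.map (λ {x} p → proj₁ (∨-false (f x) p)) (allowed m)
    ; marked = λ h p → proj₁ (∨-false (h z) p) ∷ marked m h (proj₂ (∨-false (h z) p))
    }

  none : ∀ {zs f mask} → Marks 0 zs f mask
  none = record { set = [] ; size = refl ; distinct = [] ; inside = [] ; indep = [] ; allowed = [] ; marked = λ _ _ → [] }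

  independent-sound : ∀ k m f zs {mask} → Unique zs →
                      mask ∈ independent k m (map f zs) (pat E zs) → Marks k zs f mask
  independent-sound zero    m       f zs       u p = none
  independent-sound (suc k) zero    f []       u ()
  independent-sound (suc k) zero    f (z ∷ zs) u ()
  independent-sound (suc k) (suc m) f []       u ()
  independent-sound (suc k) (suc m) f (z ∷ zs) u p with m <ᵇ k
  ... | false with f z in fz
  ...   | true with ∈-map⁻ (false ∷_) p
  ...     | _ , q , refl = skip (independent-sound (suc k) m f zs (tail-unique u) q)
  independent-sound (suc k) (suc m) f (z ∷ zs) u p | false | false
    with ∈-++⁻ (map (true ∷_) (independent k m (either (map f zs) (map (E z) zs)) (pat E zs))) p
  ... | inj₂ q with ∈-map⁻ (false ∷_) q
  ...   | _ , r , refl = skip (independent-sound (suc k) m f zs (tail-unique u) r)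
  independent-sound (suc k) (suc m) f (z ∷ zs) u p | false | false | inj₁ q with ∈-map⁻ (true ∷_) q
  ... | mask′ , r , refl =
        take fz u (independent-sound k m (λ x → f x ∨ E z x) zs (tail-unique u)
                    (subst (λ row → mask′ ∈ independent k m row (pat E zs)) (either-map f (E z) zs) r))

  hitsAll-complete : ∀ {t} ms → (∀ {m} → m ∈ ms → meets m t ≡ false → ⊥) → hitsAll ms t ≡ true
  hitsAll-complete []       f = refl
  hitsAll-complete {t} (m ∷ ms) f with meets m t in eq
  ... | true  = hitsAll-complete ms (λ p → f (there p))
  ... | false = ⊥-elim (f (here refl) eq)

  -- A vertex without neighbours in an independent `k`-set would enlarge it to an independent set of
  -- `suc k` vertices.
  independents-hit : ∀ k → (∀ vs → Unique vs → length vs ≡ suc k → Independent vs → ⊥) →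
    ∀ v vs → Unique (v ∷ vs) → hitsAll (independents k (pat E vs)) (map (E v) vs) ≡ true
  independents-hit k absent v vs u@(v∉ ∷ u′) = hitsAll-complete _ bad
    where
    bad : ∀ {m} → m ∈ independents k (pat E vs) → meets m (map (E v) vs) ≡ false → ⊥
    bad {m} p q = absent (v ∷ set M) (All.map (λ x∈ → All.lookup v∉ x∈) (inside M) ∷ distinct M)
                     (cong suc (size M)) (marked M (E v) q ∷ indep M)
      where
      M : Marks k vs (λ _ → false) m
      M = independent-sound k (length (pat E vs)) (λ _ → false) vs u′
            (subst (λ row → m ∈ independent k (length (pat E vs)) row (pat E vs)) (map-const false E vs) p)

-- Completeness of the colouring search

sameColour-sound : ∀ x y → sameColour x y ≡ true → x ≡ y
sameColour-sound R R _ = refl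
sameColour-sound G G _ = refl
sameColour-sound B B _ = refl

open NormaliseSound weighColour sameColour sameColour-sound
  using () renaming (norm-pat to normColouring-pat; ∈-dedup to ∈-dedupColourings)

C₅Free C₆Free : (V → V → Fin 3) → Fin 3 → Set
C₅Free {V} col c = ∀ (v x a b y : V) → Unique (v ∷ x ∷ a ∷ b ∷ y ∷ []) →
  col v x ≡ c → col x a ≡ c → col a b ≡ c → col b y ≡ c → col y v ≡ c → ⊥
C₆Free {V} col c = ∀ (v x a b d y : V) → Unique (v ∷ x ∷ a ∷ b ∷ d ∷ y ∷ []) →
  col v x ≡ c → col x a ≡ c → col a b ≡ c → col b d ≡ c → col d y ≡ c → col y v ≡ c → ⊥

unique-++ˡ : ∀ {A : Set} (xs : List A) {ys} → Unique (xs ++ ys) → Unique xs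
unique-++ˡ []       u        = []
unique-++ˡ (x ∷ xs) (x∉ ∷ u) = ++⁻ˡ xs x∉ ∷ unique-++ˡ xs u

unique-++ʳ : ∀ {A : Set} (xs : List A) {ys} → Unique (xs ++ ys) → Unique ys
unique-++ʳ []       u       = u
unique-++ʳ (x ∷ xs) (_ ∷ u) = unique-++ʳ xs u

module Closing (col : V → V → Fin 3) (c : Fin 3) (E : V → V → Bool) (E-sym : Sym E)
               (E-sound : ∀ x y → E x y ≡ true → col x y ≡ c) where

  open Paths E E-sym

  private
    back : ∀ v y → E v y ≡ true → col y v ≡ c
    back v y p = E-sound y v (≡-trans (E-sym y v) p)

  path₃-closing : C₅Free col c → NoClosing path₃ E
  path₃-closing free v x y zs u vx vy p with path₃-sound x y zs p
  ... | a , b , rest , r , xa , ab , by =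
    free v x a b y
      (unique-++ˡ (v ∷ x ∷ a ∷ b ∷ y ∷ []) (Unique-resp-↭ (prep v (prep x (trans (prep y r)
        (trans (swap y a refl) (prep a (swap y b refl)))))) u))
      (E-sound v x vx) (E-sound x a xa) (E-sound a b ab) (E-sound b y by) (back v y vy)

  path₄-closing : C₆Free col c → NoClosing path₄ E
  path₄-closing free v x y zs u vx vy p with path₄-sound x y zs p
  ... | a , b , d , rest , r , xa , ab , bd , dy =
    free v x a b d y
      (unique-++ˡ (v ∷ x ∷ a ∷ b ∷ d ∷ y ∷ []) (Unique-resp-↭ (prep v (prep x (trans (prep y r)
        (trans (swap y a refl) (prep a (trans (swap y b refl) (prep b (swap y d refl)))))))) u))
      (E-sound v x vx) (E-sound x a xa) (E-sound a b ab) (E-sound b d bd) (E-sound d y dy) (back v y vy)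

record Good (col : V → V → Fin 3) : Set where
  field
    col-sym   : Sym col
    diagonal  : ∀ x → sameColour R (col x x) ≡ false
    red-free  : C₅Free col R
    green-free : C₆Free col G
    blue-free : C₆Free col B

clash-meets : ∀ c f t → clash c f t ≡ meets f (map (sameColour c) t)
clash-meets c []          t       = refl
clash-meets c (true ∷ f)  []      = refl
clash-meets c (false ∷ f) []      = refl
clash-meets c (true ∷ f)  (x ∷ t) = cong (sameColour c x ∨_) (clash-meets c f t)
clash-meets c (false ∷ f) (x ∷ t) = clash-meets c f t

map-pat : ∀ {C D : Set} (f : C → D) (c : V → V → C) vs → map (map f) (pat c vs) ≡ pat (λ x y → f (c x y)) vs
map-pat f c []       = refl
map-pat f c (v ∷ vs) = cong₂ _∷_ (sym (map-∘ vs)) (map-pat f c vs)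

unless-later : ∀ b {t u ts} → u ∈ ts → u ∈ unless b t ts
unless-later true  p = p
unless-later false p = there p

unless-here : ∀ {b t ts} → b ≡ false → t ∈ unless b t ts
unless-here refl = here refl

growRed-later : ∀ k m a j t {u ts} → u ∈ ts → u ∈ growRed k m a j t ts
growRed-later k false a j t p = unless-later (clash R a t) p
growRed-later k true  a j t p with j <ᵇ k
... | true  = unless-later (clash R a t) p
... | false = p

growRed-here : ∀ k m a j t {ts} → clash R a t ≡ false → bit m + j ≤ k → (bit m + j , R ∷ t) ∈ growRed k m a j t ts
growRed-here k false a j t cl le = unless-here cl
growRed-here k true  a j t cl le rewrite <ᵇ-true le = unless-here cl

module _ (k : ℕ) (m : Bool) (a b c : List Bool) where

  private
    later : ∀ {u} j t ts → u ∈ growColours k m a b c ts → u ∈ growColours k m a b c ((j , t) ∷ ts)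
    later j t ts p = growRed-later k m a j t (unless-later (clash G b t) (unless-later (clash B c t) p))

  grow-red : ∀ {j t} ts → (j , t) ∈ ts → clash R a t ≡ false → bit m + j ≤ k →
             (bit m + j , R ∷ t) ∈ growColours k m a b c ts
  grow-red ((j , t) ∷ ts) (here refl) cl le = growRed-here k m a j t cl le
  grow-red ((j , t) ∷ ts) (there p)   cl le = later j t ts (grow-red ts p cl le)

  grow-green : ∀ {j t} ts → (j , t) ∈ ts → clash G b t ≡ false → (j , G ∷ t) ∈ growColours k m a b c ts
  grow-green ((j , t) ∷ ts) (here refl) cl = growRed-later k m a j t (unless-here cl)
  grow-green ((j , t) ∷ ts) (there p)   cl = later j t ts (grow-green ts p cl)

  grow-blue : ∀ {j t} ts → (j , t) ∈ ts → clash B c t ≡ false → (j , B ∷ t) ∈ growColours k m a b c ts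
  grow-blue ((j , t) ∷ ts) (here refl) cl = growRed-later k m a j t (unless-later (clash G b t) (unless-here cl))
  grow-blue ((j , t) ∷ ts) (there p)   cl = later j t ts (grow-blue ts p cl)

m≤bit+m : ∀ b {m} → m ≤ bit b + m
m≤bit+m true  = n≤1+n _
m≤bit+m false = ≤-refl

insertFalse-map : ∀ (h : V → Bool) p x xs → p ≤ length xs → h (select p x xs) ≡ false →
                  insertFalse p (map h (remove p x xs)) ≡ map h (x ∷ xs)
insertFalse-map h zero    x xs       _       q rewrite q = refl
insertFalse-map h (suc p) x (y ∷ ys) (s≤s l) q = cong (h x ∷_) (insertFalse-map h p y ys l q)

select-index : ∀ {A : Set} {y x : A} {xs} → y ∈ x ∷ xs → ∃ λ k → k ≤ length xs × select k x xs ≡ y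
select-index (here refl) = 0 , z≤n , refl
select-index {xs = z ∷ zs} (there p) with select-index p
... | k , l , eq = suc k , s≤s l , eq

module Colourings {V : Set} (col : V → V → Fin 3) (good : Good col) where

  open Good good

  E : Fin 3 → V → V → Bool
  E c x y = sameColour c (col x y)

  E-sym : ∀ c → Sym (E c)
  E-sym c x y = cong (sameColour c) (col-sym x y)

  E-sound : ∀ c x y → E c x y ≡ true → col x y ≡ c
  E-sound c x y p = sym (sameColour-sound c (col x y) p)

  Listed : List (Pattern (Fin 3)) → List V → Set
  Listed gs vs = ∃ λ vs′ → vs′ ↭ vs × pat col vs′ ∈ gs

  Listed-resp-↭ : ∀ {gs vs ws} → vs ↭ ws → Listed gs vs → Listed gs ws
  Listed-resp-↭ p (vs′ , q , g∈) = vs′ , trans q p , g∈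

  RedFree : List V → Set
  RedFree vs = ∀ {x y} → x ∈ vs → y ∈ vs → E R x y ≡ false

  RedFree-resp-↭ : ∀ {vs ws} → vs ↭ ws → RedFree vs → RedFree ws
  RedFree-resp-↭ p f x∈ y∈ = f (∈-resp-↭ (↭-sym p) x∈) (∈-resp-↭ (↭-sym p) y∈)

  commonRed : V → V → List V → ℕ
  commonRed w x zs = count (map (λ u → E R w u ∧ E R x u) zs)

  rows-complete : ∀ k v (μ : V → Bool) us {as bs cs} →
    Clean as (map (E R v) us) → Clean bs (map (E G v) us) → Clean cs (map (E B v) us) →
    count (map (λ u → μ u ∧ E R v u) us) ≤ k →
    (count (map (λ u → μ u ∧ E R v u) us) , map (col v) us) ∈ rows k (map μ us) as bs cs
  rows-complete k v μ [] [] [] [] le = here refl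
  rows-complete k v μ (u ∷ us) {a ∷ as} {b ∷ bs} {c ∷ cs} (okR ∷ clR) (okG ∷ clG) (okB ∷ clB) le
    with col v u in eq
  ... | R rewrite count-∷ (μ u ∧ true) (map (λ u → μ u ∧ E R v u) us) | ∧-identityʳ (μ u) =
    grow-red k (μ u) a b c _ (rows-complete k v μ us clR clG clB (≤-trans (m≤bit+m (μ u)) le))
      (≡-trans (clash-meets R a _) (≡-trans (cong (meets a) (sym (map-∘ us))) (okR refl))) le
  ... | G rewrite ∧-zeroʳ (μ u) =
    grow-green k (μ u) a b c _ (rows-complete k v μ us clR clG clB le)
      (≡-trans (clash-meets G b _) (≡-trans (cong (meets b) (sym (map-∘ us))) (okG refl)))
  ... | B rewrite ∧-zeroʳ (μ u) =
    grow-blue k (μ u) a b c _ (rows-complete k v μ us clR clG clB le)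
      (≡-trans (clash-meets B c _) (≡-trans (cong (meets c) (sym (map-∘ us))) (okB refl)))

  rowsOf-complete : ∀ k v (μ : V → Bool) vs → Unique (v ∷ vs) →
    count (map (λ u → μ u ∧ E R v u) vs) ≤ k →
    (count (map (λ u → μ u ∧ E R v u) vs) , map (col v) vs) ∈ rowsOf k (map μ vs) (pat col vs)
  rowsOf-complete k v μ vs u le
    rewrite map-pat (sameColour R) col vs | map-pat (sameColour G) col vs | map-pat (sameColour B) col vs =
    rows-complete k v μ vs
      (Conflicts.conflicts-clean path₃ (E R) (E-sym R)
        (Closing.path₃-closing col R (E R) (E-sym R) (E-sound R) red-free) v vs u)
      (Conflicts.conflicts-clean path₄ (E G) (E-sym G)
        (Closing.path₄-closing col G (E G) (E-sym G) (E-sound G) green-free) v vs u)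
      (Conflicts.conflicts-clean path₄ (E B) (E-sym B)
        (Closing.path₄-closing col B (E B) (E-sym B) (E-sound B) blue-free) v vs u)
      le

  extendBy-complete : ∀ f gs vs vs⁺ → pat col vs ∈ gs → normal (pat col vs⁺) ∈ f (pat col vs) →
                      Listed (extendBy f gs) vs⁺
  extendBy-complete f gs vs vs⁺ g∈ p
    with normColouring-pat col col-sym (map (λ _ → 1) (pat col vs⁺)) vs⁺
  ... | ws , q , eq = ws , q , subst (_∈ extendBy f gs) eq
        (∈-dedupColourings _ (∈-concatMap⁺ f (Any.map (λ { refl → p }) g∈)))

  attachAll-complete : ∀ {j t} g ts → (j , t) ∈ ts → normal (t ∷ g) ∈ attachAll g ts
  attachAll-complete g ts p = ∈-map⁺ (λ t → normal (proj₂ t ∷ g)) p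

  count-none : ∀ (f : V → Bool) us → (∀ {u} → u ∈ us → f u ≡ false) → count (map f us) ≡ 0
  count-none f []       p = refl
  count-none f (u ∷ us) p rewrite p (here refl) = count-none f us (λ q → p (there q))

  opaque
    unfolding redFreeOf

    redFreeOf-complete : ∀ n vs → Unique vs → length vs ≡ n → RedFree vs → Listed (redFreeOf n) vs
    redFreeOf-complete zero    []       u len f = [] , refl , here refl
    redFreeOf-complete (suc n) (v ∷ vs) u len f
      with redFreeOf-complete n vs (tail-unique u) (suc-injective len) (λ x∈ y∈ → f (there x∈) (there y∈))
    ... | us , p , g∈ = Listed-resp-↭ (prep v p) (extendBy-complete redFreeExt (redFreeOf n) us (v ∷ us) g∈ here′)
      where
      here′ : normal (pat col (v ∷ us)) ∈ redFreeExt (pat col us)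
      here′ rewrite map-const true col us =
        attachAll-complete (pat col us) _
          (rowsOf-complete 0 v (λ _ → true) us (Unique-resp-↭ (prep v (↭-sym p)) u)
            (≤-reflexive (count-none (E R v) us (λ q → f (here refl) (there (∈-resp-↭ p q))))))

  anyExt-∈ : ∀ v us → Unique (v ∷ us) → normal (pat col (v ∷ us)) ∈ anyExt (pat col us)
  anyExt-∈ v us u rewrite map-const false col us =
    attachAll-complete (pat col us) _ (rowsOf-complete 0 v (λ _ → false) us u
      (≤-reflexive (count-none (λ _ → false) us (λ _ → refl))))

  anyExt-complete : ∀ gs v vs → Unique (v ∷ vs) → Listed gs vs → Listed (extendBy anyExt gs) (v ∷ vs)
  anyExt-complete gs v vs u (us , p , g∈) =
    Listed-resp-↭ (prep v p) (extendBy-complete anyExt gs us (v ∷ us) g∈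
      (anyExt-∈ v us (Unique-resp-↭ (prep v (↭-sym p)) u)))

  noRed-complete : ∀ v us → (∀ {u} → u ∈ us → E R v u ≡ false) → noRed (map (col v) us) ≡ true
  noRed-complete v []       f = refl
  noRed-complete v (u ∷ us) f rewrite f (here refl) = noRed-complete v us (λ q → f (there q))

  redFree-complete : ∀ vs → RedFree vs → redFree (pat col vs) ≡ true
  redFree-complete []       f = refl
  redFree-complete (v ∷ vs) f rewrite noRed-complete v vs (λ q → f (here refl) (there q)) =
    redFree-complete vs (λ x∈ y∈ → f (there x∈) (there y∈))

  splits-complete : ∀ m p i t g → i < m → redFree (delete (i + p) t g) ≡ true →
                    (i + p , rowAt (i + p) t g) ∈ splits m p t g
  splits-complete (suc m) p zero    t g _       ok rewrite ok = here refl
  splits-complete (suc m) p (suc i) t g (s≤s l) ok rewrite sym (+-suc i p) with redFree (delete p t g)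
  ... | true  = there (splits-complete m (suc p) i t g l ok)
  ... | false = splits-complete m (suc p) i t g l ok

  locate : ∀ (w : V) (S zs : List V) → zs ↭ w ∷ S → ∃₂ λ y ys → ∃ λ p → zs ≡ y ∷ ys × p ≤ length ys ×
           select p y ys ≡ w × remove p y ys ↭ S
  locate w S []       q with ∈-resp-↭ (↭-sym q) (here refl)
  ... | ()
  locate w S (y ∷ ys) q with select-index (∈-resp-↭ (↭-sym q) (here refl))
  ... | p , l , refl = y , ys , p , refl , l , refl , drop-∷ (trans (↭-sym (select-remove p y ys)) q)

  splitsOf-complete : ∀ y ys p → p ≤ length ys → RedFree (remove p y ys) →
    (p , map (col (select p y ys)) (remove p y ys)) ∈ splitsOf (pat col (y ∷ ys))
  splitsOf-complete y ys p l f
    with splits-complete (suc (length (pat col ys))) 0 p (map (col y) ys) (pat col ys)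
           (s≤s (subst (p ≤_) (sym (length-pat col ys)) l))
  ... | found rewrite +-identityʳ p | delete-pat col p y ys | rowAt-pat col col-sym p y ys =
        found (redFree-complete (remove p y ys) f)

  pairExt-∈ : ∀ w x (S us : List V) → Unique (x ∷ us) → us ↭ w ∷ S → RedFree S → commonRed w x S ≤ 1 →
              normal (pat col (x ∷ us)) ∈ pairExt (pat col us)
  pairExt-∈ w x S us u q f le with locate w S us q
  ... | y , ys , p , refl , l , refl , r =
    ∈-concatMap⁺ _ (Any.map (λ { refl → inner }) (splitsOf-complete y ys p l (RedFree-resp-↭ (↭-sym r) f)))
    where
    -- The inserted `false` is the value of `E R w` at `w` itself, by `diagonal`; so the mask is the
    -- red row of `w` over the whole list.
    masked : insertFalse p (map (sameColour R) (map (col (select p y ys)) (remove p y ys))) ≡ map (E R (select p y ys)) (y ∷ ys)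
    masked rewrite sym (map-∘ {g = sameColour R} {f = col (select p y ys)} (remove p y ys)) =
      insertFalse-map (E R (select p y ys)) p y ys l (diagonal _)
    few : commonRed (select p y ys) x (y ∷ ys) ≤ 1
    few = subst (_≤ 1) (sym (≡-trans (count-↭ (λ u → E R (select p y ys) u ∧ E R x u) q) skip-w)) le
      where
      skip-w : commonRed (select p y ys) x (select p y ys ∷ S) ≡ commonRed (select p y ys) x S
      skip-w rewrite diagonal (select p y ys) = refl
    inner : normal (pat col (x ∷ y ∷ ys)) ∈
            attachAll (pat col (y ∷ ys)) (rowsOf 1 (insertFalse p (map (sameColour R) (map (col (select p y ys)) (remove p y ys)))) (pat col (y ∷ ys)))
    inner rewrite masked =
      attachAll-complete (pat col (y ∷ ys)) _ (rowsOf-complete 1 x (E R (select p y ys)) (y ∷ ys) u few)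

  common-map : ∀ w x zs → common (map (col w) zs) (map (col x) zs) ≡ commonRed w x zs
  common-map w x []       = refl
  common-map w x (z ∷ zs) with E R w z ∧ E R x z
  ... | true  = cong suc (common-map w x zs)
  ... | false = common-map w x zs

  closeTo-complete : ∀ z zs {q w} qs → (q , w) ∈ qs → (common (remove q z zs) w <ᵇ 2) ≡ true → closeTo (z ∷ zs) qs ≡ true
  closeTo-complete z zs ((q , w) ∷ qs) (here refl) ok rewrite ok = refl
  closeTo-complete z zs ((q , w) ∷ qs) (there p)   ok with common (remove q z zs) w <ᵇ 2
  ... | true  = refl
  ... | false = closeTo-complete z zs qs p ok

  hubs-complete : ∀ m p i t g → i < m → closeTo (rowAt (i + p) t g) (splitsOf (delete (i + p) t g)) ≡ true →
                  (i + p) ∈ hubs m p t g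
  hubs-complete (suc m) p zero    t g _       ok rewrite ok = here refl
  hubs-complete (suc m) p (suc i) t g (s≤s l) ok rewrite sym (+-suc i p)
    with closeTo (rowAt p t g) (splitsOf (delete p t g))
  ... | true  = there (hubs-complete m (suc p) i t g l ok)
  ... | false = hubs-complete m (suc p) i t g l ok

  closeTo-rows : ∀ w x (S us : List V) → us ↭ x ∷ S → RedFree S → commonRed w x S ≤ 1 →
                 closeTo (map (col w) us) (splitsOf (pat col us)) ≡ true
  closeTo-rows w x S us q f le with locate x S us q
  ... | y , ys , p , refl , l , refl , r =
    closeTo-complete (col w y) (map (col w) ys) _ (splitsOf-complete y ys p l (RedFree-resp-↭ (↭-sym r) f)) small
    where
    small : (common (remove p (col w y) (map (col w) ys)) (map (col (select p y ys)) (remove p y ys)) <ᵇ 2) ≡ true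
    small rewrite remove-map (col w) p y ys | common-map w (select p y ys) (remove p y ys) =
      <ᵇ-true (s≤s (subst (_≤ 1) (sym (count-↭ (λ u → E R w u ∧ E R (select p y ys) u) r)) le))

  redAt-complete : ∀ z zs {p} ps → p ∈ ps → sameColour R (select p z zs) ≡ true → redAt (z ∷ zs) ps ≡ true
  redAt-complete z zs (p ∷ ps) (here refl) ok rewrite ok = refl
  redAt-complete z zs (p ∷ ps) (there q)   ok with sameColour R (select p z zs)
  ... | true  = refl
  ... | false = redAt-complete z zs ps q ok

  attachRed-complete : ∀ ps g {j t} ts → (j , t) ∈ ts → redAt t ps ≡ true → normal (t ∷ g) ∈ attachRed ps g ts
  attachRed-complete ps g ((j , t) ∷ ts) (here refl) ok rewrite ok = here refl
  attachRed-complete ps g ((j , t) ∷ ts) (there p)   ok with redAt t ps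
  ... | true  = there (attachRed-complete ps g ts p ok)
  ... | false = attachRed-complete ps g ts p ok

  hubExt-∈ : ∀ v w x (S us : List V) → Unique (v ∷ us) → us ↭ w ∷ x ∷ S → RedFree S → commonRed w x S ≤ 1 →
             E R v w ≡ true → normal (pat col (v ∷ us)) ∈ hubExt (pat col us)
  hubExt-∈ v w x S us u q f le vw with locate w (x ∷ S) us q
  ... | y , ys , p , refl , l , refl , r =
    attachRed-complete _ (pat col (y ∷ ys)) _ row (redAt-complete (col v y) (map (col v) ys) _ hub red)
    where
    row : (count (map (λ u → false ∧ E R v u) (y ∷ ys)) , map (col v) (y ∷ ys)) ∈
          rowsOf 0 (map (λ _ → false) (pat col (y ∷ ys))) (pat col (y ∷ ys))
    row = subst (λ ms → (count (map (λ u → false ∧ E R v u) (y ∷ ys)) , map (col v) (y ∷ ys)) ∈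
                        rowsOf 0 ms (pat col (y ∷ ys))) (sym (map-const false col (y ∷ ys)))
            (rowsOf-complete 0 v (λ _ → false) (y ∷ ys) u
              (≤-reflexive (count-none (λ _ → false) (y ∷ ys) (λ _ → refl))))
    red : sameColour R (select p (col v y) (map (col v) ys)) ≡ true
    red rewrite select-map (col v) p y ys = vw
    hub : p ∈ hubsOf (pat col (y ∷ ys))
    hub with hubs-complete (suc (length (pat col ys))) 0 p (map (col y) ys) (pat col ys)
               (s≤s (subst (p ≤_) (sym (length-pat col ys)) l))
    ... | found rewrite +-identityʳ p | delete-pat col p y ys | rowAt-pat col col-sym p y ys =
          found (closeTo-rows (select p y ys) x S (remove p y ys) r f le)

-- Excluding red-free sets of seven vertices

meets-complete : ∀ (g h : V → Bool) zs → 1 ≤ count (map (λ u → g u ∧ h u) zs) → meets (map g zs) (map h zs) ≡ true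
meets-complete g h (z ∷ zs) p with g z
... | false = meets-complete g h zs p
... | true with h z
...   | true  = refl
...   | false = meets-complete g h zs p

-- Two candidates on either side always allow distinct choices. If the current vertex serves both
-- sides, it is used for one, and the other side still has a candidate further on.
fork-complete : ∀ (f g h : V → Bool) zs → 2 ≤ count (map (λ u → f u ∧ h u) zs) → 2 ≤ count (map (λ u → g u ∧ h u) zs) →
                fork (map f zs) (map g zs) (map h zs) ≡ true
fork-complete f g h (z ∷ zs) p q with h z
fork-complete f g h (z ∷ zs) p q | false with f z | g z
... | false | false = fork-complete f g h zs p q
... | false | true  = fork-complete f g h zs p q
... | true  | false = fork-complete f g h zs p q
... | true  | true  = fork-complete f g h zs p q
fork-complete f g h (z ∷ zs) p q | true with f z | g z
... | true  | true  rewrite meets-complete g h zs (≤-pred q) = refl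
... | true  | false rewrite meets-complete g h zs (≤-trans (s≤s z≤n) q) = refl
... | false | true  rewrite meets-complete f h zs (≤-trans (s≤s z≤n) p) = refl
... | false | false = fork-complete f g h zs p q

∈-split : ∀ {A : Set} {x : A} {ys} → x ∈ ys → ∃ λ zs → ys ↭ x ∷ zs
∈-split {ys = y ∷ ys} (here refl) = ys , refl
∈-split {ys = y ∷ ys} (there p) with ∈-split p
... | zs , q = y ∷ zs , trans (prep y q) (swap y _ refl)

∈-shrink : ∀ {A : Set} {x y : A} {zs} → x ≢ y → y ∈ x ∷ zs → y ∈ zs
∈-shrink x≢y (here refl) = ⊥-elim (x≢y refl)
∈-shrink x≢y (there p)   = p

complement : ∀ {A : Set} (xs ys : List A) → Unique xs → All (_∈ ys) xs → ∃ λ zs → ys ↭ xs ++ zs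
complement []       ys u        _          = ys , refl
complement (x ∷ xs) ys (x∉ ∷ u) (x∈ ∷ xs∈) with ∈-split x∈
... | zs , q with complement xs zs u (All.zipWith (λ { (x≢ , p) → ∈-shrink x≢ (∈-resp-↭ q p) }) (x∉ , xs∈))
...   | rest , r = rest , trans q (prep x r)

exchange-red : ∀ c → sameColour R (exchange c) ≡ sameColour R c
exchange-red R = refl
exchange-red G = refl
exchange-red B = refl

exchange-good : {col : V → V → Fin 3} → Good col → Good (λ x y → exchange (col x y))
exchange-good {col = col} good = record
  { col-sym = λ x y → cong exchange (col-sym x y)
  ; diagonal = λ x → ≡-trans (exchange-red (col x x)) (diagonal x)
  ; red-free = λ v x a b y u p q r s t → red-free v x a b y u (toR _ p) (toR _ q) (toR _ r) (toR _ s) (toR _ t)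
  ; green-free = λ v x a b d y u p q r s t w → blue-free v x a b d y u (toB _ p) (toB _ q) (toB _ r) (toB _ s) (toB _ t) (toB _ w)
  ; blue-free = λ v x a b d y u p q r s t w → green-free v x a b d y u (toG _ p) (toG _ q) (toG _ r) (toG _ s) (toG _ t) (toG _ w)
  }
  where
  open Good good
  toR : ∀ c → exchange c ≡ R → c ≡ R
  toR R _ = refl
  toR G ()
  toR B ()
  toB : ∀ c → exchange c ≡ G → c ≡ B
  toB R ()
  toB G ()
  toB B _ = refl
  toG : ∀ c → exchange c ≡ B → c ≡ G
  toG R ()
  toG G _ = refl
  toG B ()

-- From the inside out, the extensions add `w`, then `x`, then `w′`, then the five other vertices: 7
-- + 3 + 5 = 15. The vertex `w′` comes after `x` so that `hubExt` can use the bound on common red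
-- neighbours to find `w`.
descend : List (Pattern (Fin 3)) → List (Pattern (Fin 3))
descend gs = repeated 5 (extendBy anyExt) (extendBy hubExt (extendBy pairExt (extendBy anyExt gs)))

modExchange : List (Pattern (Fin 3)) → List (Pattern (Fin 3))
modExchange gs = dedupColourings (map upToExchange gs)

module SevenSets {V : Set} (col : V → V → Fin 3) (good : Good col) where

  open Good good
  open Colourings col good

  redNeighbour : ∀ v vs → (∀ {u} → u ∈ vs → E R v u ≡ false) ⊎ (∃₂ λ u rest → vs ↭ u ∷ rest × E R v u ≡ true)
  redNeighbour v [] = inj₁ λ ()
  redNeighbour v (w ∷ ws) with E R v w in eq
  ... | true = inj₂ (w , ws , refl , eq)
  ... | false with redNeighbour v ws
  ...   | inj₁ f = inj₁ λ { (here refl) → eq ; (there p) → f p }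
  ...   | inj₂ (u , rest , p , e) = inj₂ (u , w ∷ rest , trans (prep w p) (swap w u refl) , e)

  redEdge : ∀ vs → RedFree vs ⊎ (∃₂ λ x y → ∃ λ rest → vs ↭ x ∷ y ∷ rest × E R x y ≡ true)
  redEdge [] = inj₁ λ ()
  redEdge (v ∷ vs) with redNeighbour v vs
  ... | inj₂ (u , rest , p , e) = inj₂ (v , u , rest , prep v p , e)
  ... | inj₁ f with redEdge vs
  ...   | inj₂ (x , y , rest , p , e) =
          inj₂ (x , y , v ∷ rest , trans (prep v p) (↭-sym (shift v (x ∷ y ∷ []) rest)) , e)
  ...   | inj₁ h = inj₁ λ
          { (here refl) (here refl) → diagonal v
          ; (here refl) (there q)   → f q
          ; (there p)   (here refl) → ≡-trans (E-sym R _ v) (f p)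
          ; (there p)   (there q)   → h p q }

  anyExts-complete : ∀ ys gs vs → Unique (ys ++ vs) → Listed gs vs →
                     Listed (repeated (length ys) (extendBy anyExt) gs) (ys ++ vs)
  anyExts-complete []       gs vs u l = l
  anyExts-complete (y ∷ ys) gs vs u l = anyExt-complete _ y (ys ++ vs) u (anyExts-complete ys gs vs (tail-unique u) l)

  descend-complete : ∀ gs S w w′ x ys → Unique (ys ++ w′ ∷ x ∷ w ∷ S) → RedFree S → E R w′ w ≡ true →
    commonRed w x S ≤ 1 → length ys ≡ 5 → Listed gs S → Listed (descend gs) (ys ++ w′ ∷ x ∷ w ∷ S)
  descend-complete gs S w w′ x ys u f red few len l =
    subst (λ n → Listed (repeated n (extendBy anyExt) (extendBy hubExt (extendBy pairExt (extendBy anyExt gs)))) (ys ++ w′ ∷ x ∷ w ∷ S))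
      len (anyExts-complete ys _ _ u (ten (nine (anyExt-complete gs w S (tail-unique (tail-unique u₁₀)) l))))
    where
    u₁₀ : Unique (w′ ∷ x ∷ w ∷ S)
    u₁₀ = unique-++ʳ ys u
    nine : ∀ {hs} → Listed hs (w ∷ S) → Listed (extendBy pairExt hs) (x ∷ w ∷ S)
    nine {hs} (us , p , g∈) = Listed-resp-↭ (prep x p)
      (extendBy-complete pairExt hs us (x ∷ us) g∈
        (pairExt-∈ w x S us (Unique-resp-↭ (prep x (↭-sym p)) (tail-unique u₁₀)) p f few))
    ten : ∀ {hs} → Listed hs (x ∷ w ∷ S) → Listed (extendBy hubExt hs) (w′ ∷ x ∷ w ∷ S)
    ten {hs} (us , p , g∈) = Listed-resp-↭ (prep w′ p)
      (extendBy-complete hubExt hs us (w′ ∷ us) g∈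
        (hubExt-∈ w′ w x S us (Unique-resp-↭ (prep w′ (↭-sym p)) u₁₀) (trans p (swap x w refl)) f few red))

  Listed-[] : ∀ {gs vs} → gs ≡ [] → Listed gs vs → ⊥
  Listed-[] refl (_ , _ , ())

  no-listed-seven : ∀ gs → descend gs ≡ [] →
    (∀ vs → Unique vs → length vs ≡ 8 → RedFree vs → ⊥) →
    ∀ S W → Unique (S ++ W) → length W ≡ 8 → RedFree S → Listed gs S → ⊥
  no-listed-seven gs empty no-eight S W u len f l with redEdge W
  ... | inj₁ free = no-eight W (unique-++ʳ S u) len free
  ... | inj₂ (w , w′ , [] , p , ww′) with ≡-trans (sym len) (↭-length p)
  ...   | ()
  no-listed-seven gs empty no-eight S W u len f l | inj₂ (w , w′ , x ∷ ys , p , ww′)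
    with commonRed w x S ≤? 1 | commonRed w′ x S ≤? 1
  ... | yes few | _ =
    Listed-[] empty (descend-complete gs S w w′ x ys (Unique-resp-↭ arrange u) f (≡-trans (E-sym R w′ w) ww′) few len′ l)
    where
    len′ : length ys ≡ 5
    len′ = suc-injective (suc-injective (suc-injective (≡-trans (sym (↭-length p)) len)))
    arrange : S ++ W ↭ ys ++ w′ ∷ x ∷ w ∷ S
    arrange = trans (++-comm S W) (trans (++⁺ʳ S p) (trans (trans (swap w w′ refl) (prep w′ (swap w x refl))) (shifts (w′ ∷ x ∷ w ∷ []) ys)))
  ... | no _ | yes few =
    Listed-[] empty (descend-complete gs S w′ w x ys (Unique-resp-↭ arrange u) f ww′ few len′ l)
    where
    len′ : length ys ≡ 5
    len′ = suc-injective (suc-injective (suc-injective (≡-trans (sym (↭-length p)) len)))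
    arrange : S ++ W ↭ ys ++ w ∷ x ∷ w′ ∷ S
    arrange = trans (++-comm S W) (trans (++⁺ʳ S p) (trans (prep w (swap w′ x refl)) (shifts (w ∷ x ∷ w′ ∷ []) ys)))
  ... | no many | no many′
    with Paths.fork-sound (E R) (E-sym R) w w′ x S (fork-complete (E R w) (E R w′) (E R x) S (≰⇒> many) (≰⇒> many′))
  ...   | a , d , rest , r , wa , ax , xd , dw′ =
    red-free w′ w a x d
      (unique-++ˡ (w′ ∷ w ∷ a ∷ x ∷ d ∷ []) {rest ++ ys} (Unique-resp-↭ arrange u))
      (E-sound R w′ w (≡-trans (E-sym R w′ w) ww′)) (E-sound R w a wa) (E-sound R a x ax) (E-sound R x d xd) (E-sound R d w′ dw′)
    where
    arrange : S ++ W ↭ w′ ∷ w ∷ a ∷ x ∷ d ∷ rest ++ ys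
    arrange = trans (++-comm S W) (trans (++⁺ʳ S p)
      (swap w w′ (trans (prep x (++-comm ys S)) (trans (prep x (++⁺ʳ ys r)) (swap x a refl)))))

module FifteenVertices
  {V : Set} (all : List V) (everything : ∀ v → v ∈ all) (fifteen : length all ≡ 15) (distinct : Unique all)
  (sevens : List (Pattern (Fin 3)))
  (sevens-complete : (col : V → V → Fin 3) (good : Good col) → ∀ vs → Unique vs → length vs ≡ 7 →
                     Colourings.RedFree col good vs → Colourings.Listed col good sevens vs)
  (descend-sevens : descend (modExchange sevens) ≡ [])
  (no-eight : (col : V → V → Fin 3) (good : Good col) → ∀ vs → Unique vs → length vs ≡ 8 →
              Colourings.RedFree col good vs → ⊥)
  where

  length-rest : ∀ S W → length S ≡ 7 → all ↭ S ++ W → length W ≡ 8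
  length-rest S W len p = +-cancelˡ-≡ 7 _ _ (subst (λ n → n + length W ≡ 15) len
    (≡-trans (sym (length-++ S)) (≡-trans (sym (↭-length p)) fifteen)))

  module _ (col : V → V → Fin 3) (good : Good col) where

    private
      col′ : V → V → Fin 3
      col′ x y = exchange (col x y)
      good′ : Good col′
      good′ = exchange-good good
    open Good good
    open Colourings col good
    module Exchanged = Colourings col′ good′
    open NormaliseSound weighColour sameColour sameColour-sound using (∈-dedup; norm-pat)

    -- If the exchanged pattern is the one kept, it is a pattern of the colouring `col′`, which is
    -- good as well. The descent is then carried out for `col′` in place of `col`.
    modExchange-complete : ∀ gs vs → Listed gs vs → Listed (modExchange gs) vs ⊎ Exchanged.Listed (modExchange gs) vs
    modExchange-complete gs vs (us , p , g∈) = which (proj₁ h <ᵇ proj₁ g) (∈-dedup _ (∈-map⁺ upToExchange g∈))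
      where
      g = normal (pat col us)
      h = normal (map (map exchange) (pat col us))
      which : ∀ b → proj₂ (if b then h else g) ∈ modExchange gs → Listed (modExchange gs) vs ⊎ Exchanged.Listed (modExchange gs) vs
      which false q with norm-pat col col-sym (map (λ _ → 1) (pat col us)) us
      ... | ws , r , eq = inj₁ (ws , trans r p , subst (_∈ modExchange gs) eq q)
      which true q rewrite map-pat exchange col us
        with norm-pat col′ (Good.col-sym good′) (map (λ _ → 1) (pat col′ us)) us
      ... | ws , r , eq = inj₂ (ws , trans r p , subst (_∈ modExchange gs) eq q)

    exchange-redFree : ∀ {S} → RedFree S → Exchanged.RedFree S
    exchange-redFree f {x} {y} x∈ y∈ = ≡-trans (exchange-red (col x y)) (f x∈ y∈)

    no-seven-in : ∀ gs → descend (modExchange gs) ≡ [] → ∀ S → Unique S → length S ≡ 7 → RedFree S → Listed gs S → ⊥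
    no-seven-in gs empty S u len f l with complement S all u (All.tabulate (λ {v} _ → everything v))
    ... | W , p with modExchange-complete gs S l
    ...   | inj₁ l₁ = SevenSets.no-listed-seven col good (modExchange gs) empty (no-eight col good) S W
                        (Unique-resp-↭ p distinct) (length-rest S W len p) f l₁
    ...   | inj₂ l₂ = SevenSets.no-listed-seven col′ good′ (modExchange gs) empty (no-eight col′ good′) S W
                        (Unique-resp-↭ p distinct) (length-rest S W len p) (exchange-redFree f) l₂

    no-seven : ∀ S → Unique S → length S ≡ 7 → RedFree S → ⊥
    no-seven S u len f = no-seven-in sevens descend-sevens S u len f (sevens-complete col good S u len f)
 

-- The computations

-- The thresholds for 15, 14, … , 1 vertices; each is the largest number allowed by its predecessor
-- (except that graphs on 2 vertices are not restricted).
abstract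
  thresholds₅ thresholds₆ : List ℕ
  thresholds₅ = 37 ∷ 33 ∷ 29 ∷ 25 ∷ 21 ∷ 18 ∷ 15 ∷ 12 ∷ 9 ∷ 7 ∷ 5 ∷ 3 ∷ 2 ∷ 0 ∷ 0 ∷ []
  thresholds₆ = 35 ∷ 31 ∷ 27 ∷ 23 ∷ 20 ∷ 17 ∷ 14 ∷ 11 ∷ 9 ∷ 7 ∷ 5 ∷ 3 ∷ 2 ∷ 0 ∷ 0 ∷ []

  valid₅ : valid thresholds₅ ≡ true × length thresholds₅ ≡ 15 × threshold thresholds₅ ≡ 37
  valid₅ = refl , refl , refl

  valid₆ : valid thresholds₆ ≡ true × length thresholds₆ ≡ 15 × threshold thresholds₆ ≡ 35
  valid₆ = refl , refl , refl

  run₅-empty : Chain.run path₃ (independents 6) thresholds₅ ≡ []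
  run₅-empty = refl

  run₆-empty : Chain.run path₄ (λ _ → []) thresholds₆ ≡ []
  run₆-empty = refl

opaque
  unfolding redFreeOf

  -- This is $R(C_6,C_6) ≤ 8$, obtained by search.
  eights-empty : redFreeOf 8 ≡ []
  eights-empty = refl

  descend-sevens : descend (modExchange (redFreeOf 7)) ≡ []
  descend-sevens = refl

-- Counting the edges of K₁₅

differ : Fin 15 → Fin 15 → Bool
differ x y = not (does (x ≟ y))

differ-sym : Sym differ
differ-sym x y with x ≟ y | y ≟ x
... | yes _    | yes _   = refl
... | yes refl | no y≢x  = ⊥-elim (y≢x refl)
... | no x≢y   | yes y≡x = ⊥-elim (x≢y (sym y≡x))
... | no _     | no _    = refl

differ-irr : ∀ x → differ x x ≡ false
differ-irr x with x ≟ x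
... | yes _  = refl
... | no x≢x = ⊥-elim (x≢x refl)

differ-≢ : ∀ {x y} → x ≢ y → differ x y ≡ true
differ-≢ {x} {y} x≢y with x ≟ y
... | yes x≡y = ⊥-elim (x≢y x≡y)
... | no _    = refl

pairs : ℕ → ℕ
pairs zero    = 0
pairs (suc n) = n + pairs n

AllPairs-∈ : ∀ {A : Set} {P : A → A → Set} → (∀ {x y} → P x y → P y x) →
             ∀ {xs x y} → AllPairs P xs → x ∈ xs → y ∈ xs → x ≡ y ⊎ P x y
AllPairs-∈ s (p ∷ ps) (here refl) (here refl) = inj₁ refl
AllPairs-∈ s (p ∷ ps) (here refl) (there q)   = inj₂ (All.lookup p q)
AllPairs-∈ s (p ∷ ps) (there q)   (here refl) = inj₂ (s (All.lookup p q))
AllPairs-∈ s (p ∷ ps) (there q)   (there r)   = AllPairs-∈ s ps q r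

abstract
  vertices : List (Fin 15)
  vertices = allFin 15

  vertices-unique : Unique vertices
  vertices-unique = allFin⁺ 15

  ∈-vertices : ∀ v → v ∈ vertices
  ∈-vertices = ∈-allFin

  length-vertices : length vertices ≡ 15
  length-vertices = refl

module Contradiction (col : Fin 15 → Fin 15 → Fin 3) (good : Good col) where

  open Good good
  open Colourings col good using (RedFree)

  -- The colouring also assigns colours on the diagonal. Cutting these off with `differ` makes all
  -- three colour graphs loopless, as the degree count requires.
  Edge : Fin 3 → Fin 15 → Fin 15 → Bool
  Edge c x y = differ x y ∧ sameColour c (col x y)

  Edge-sym : ∀ c → Sym (Edge c)
  Edge-sym c x y = cong₂ _∧_ (differ-sym x y) (cong (sameColour c) (col-sym x y))

  Edge-irr : ∀ c x → Edge c x x ≡ false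
  Edge-irr c x rewrite differ-irr x = refl

  Edge-sound : ∀ c x y → Edge c x y ≡ true → col x y ≡ c
  Edge-sound c x y p = sym (sameColour-sound c (col x y) (proj₂ (∧-true (differ x y) p)))

  row-total : ∀ v us → All (v ≢_) us →
    count (map (Edge R v) us) + (count (map (Edge G v) us) + count (map (Edge B v) us)) ≡ length us
  row-total v []       []       = refl
  row-total v (u ∷ us) (p ∷ ps) rewrite differ-≢ p with col v u
  ... | R = cong suc (row-total v us ps)
  ... | G = ≡-trans (+-suc (count (map (Edge R v) us)) _) (cong suc (row-total v us ps))
  ... | B = ≡-trans (cong (count (map (Edge R v) us) +_) (+-suc (count (map (Edge G v) us)) _))
              (≡-trans (+-suc (count (map (Edge R v) us)) _) (cong suc (row-total v us ps)))

  edges-total : ∀ vs → Unique vs →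
    edges (pat (Edge R) vs) + (edges (pat (Edge G) vs) + edges (pat (Edge B) vs)) ≡ pairs (length vs)
  edges-total []       _        = refl
  edges-total (v ∷ vs) (p ∷ ps) =
    ≡-trans (regroup (count (map (Edge R v) vs)) (edges (pat (Edge R) vs)) (count (map (Edge G v) vs)) (edges (pat (Edge G) vs)) (count (map (Edge B v) vs)) (edges (pat (Edge B) vs)))
      (cong₂ _+_ (row-total v vs p) (edges-total vs ps))
    where
    open +-*-Solver
    regroup : ∀ a a′ b b′ c c′ → a + a′ + (b + b′ + (c + c′)) ≡ a + (b + c) + (a′ + (b′ + c′))
    regroup = solve 6 (λ a a′ b b′ c c′ → a :+ a′ :+ (b :+ b′ :+ (c :+ c′)) := a :+ (b :+ c) :+ (a′ :+ (b′ :+ c′))) refl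

  no-seven : ∀ S → Unique S → length S ≡ 7 → RedFree S → ⊥
  no-seven = FifteenVertices.no-seven vertices ∈-vertices length-vertices vertices-unique
    (redFreeOf 7) (λ col good → Colourings.redFreeOf-complete col good 7) descend-sevens
    (λ col good vs u len f → SevenSets.Listed-[] col good eights-empty (Colourings.redFreeOf-complete col good 8 vs u len f))
    col good

  no-independent-seven : ∀ vs → Unique vs → length vs ≡ 7 → Independence.Independent (Edge R) vs → ⊥
  no-independent-seven vs u len ind = no-seven vs u len free
    where
    nonred : ∀ {x y} → x ≡ y ⊎ Edge R x y ≡ false → sameColour R (col x y) ≡ false
    nonred {x} (inj₁ refl) = diagonal x
    nonred {x} {y} (inj₂ p) with x ≟ y
    ... | yes refl = diagonal x
    ... | no _     = p
    free : RedFree vs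
    free x∈ y∈ = nonred (AllPairs-∈ (λ {x} {y} p → ≡-trans (Edge-sym R y x) p) ind x∈ y∈)

  module Close (c : Fin 3) = Closing col c (Edge c) (Edge-sym c) (Edge-sound c)

  few-red : edges (pat (Edge R) vertices) < 37
  few-red = subst (edges (pat (Edge R) vertices) <_) (proj₂ (proj₂ valid₅))
    (ChainSound.few-edges path₃ (independents 6) (Edge R) (Edge-sym R) (Edge-irr R)
      (Close.path₃-closing R red-free) (Independence.independents-hit (Edge R) 6 no-independent-seven)
      thresholds₅ (proj₁ valid₅) run₅-empty vertices vertices-unique
      (≡-trans length-vertices (sym (proj₁ (proj₂ valid₅)))))

  few-in : ∀ c → C₆Free col c → edges (pat (Edge c) vertices) < 35
  few-in c free = subst (edges (pat (Edge c) vertices) <_) (proj₂ (proj₂ valid₆))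
    (ChainSound.few-edges path₄ (λ _ → []) (Edge c) (Edge-sym c) (Edge-irr c)
      (Close.path₄-closing c free) (λ _ _ _ → refl)
      thresholds₆ (proj₁ valid₆) run₆-empty vertices vertices-unique
      (≡-trans length-vertices (sym (proj₁ (proj₂ valid₆)))))

  contradiction : ⊥
  -- The strict bounds become 36, 34 and 34, with sum 104, while K₁₅ has 105 edges.
  contradiction = <-irrefl (≡-trans (edges-total vertices vertices-unique) (cong pairs length-vertices))
    (s≤s (+-mono-≤ (≤-pred few-red) (+-mono-≤ (≤-pred (few-in G green-free)) (≤-pred (few-in B blue-free)))))

-- The upper bound

lookup-injective : ∀ {A : Set} {xs : List A} → Unique xs → Injective _≡_ _≡_ (lookup xs)
lookup-injective {xs = x ∷ xs} (x∉ ∷ u) {zero}  {zero}  eq = refl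
lookup-injective {xs = x ∷ xs} (x∉ ∷ u) {zero}  {suc j} eq = ⊥-elim (All.lookup x∉ (∈-lookup j) eq)
lookup-injective {xs = x ∷ xs} (x∉ ∷ u) {suc i} {zero}  eq = ⊥-elim (All.lookup x∉ (∈-lookup i) (sym eq))
lookup-injective {xs = x ∷ xs} (x∉ ∷ u) {suc i} {suc j} eq = cong suc (lookup-injective u eq)

module _ (c : Colouring 3 15) where

  Cycle₅ Cycle₆ : Fin 3 → Set
  Cycle₅ k = ∃ λ v → ∃ λ x → ∃ λ a → ∃ λ b → ∃ λ y → Unique (v ∷ x ∷ a ∷ b ∷ y ∷ []) ×
    (col c v x ≡ k × col c x a ≡ k × col c a b ≡ k × col c b y ≡ k × col c y v ≡ k)
  Cycle₆ k = ∃ λ v → ∃ λ x → ∃ λ a → ∃ λ b → ∃ λ d → ∃ λ y → Unique (v ∷ x ∷ a ∷ b ∷ d ∷ y ∷ []) ×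
    (col c v x ≡ k × col c x a ≡ k × col c a b ≡ k × col c b d ≡ k × col c d y ≡ k × col c y v ≡ k)

  cycle₅? : ∀ k → Dec (Cycle₅ k)
  cycle₅? k = any? λ v → any? λ x → any? λ a → any? λ b → any? λ y → unique? (v ∷ x ∷ a ∷ b ∷ y ∷ []) ×-dec
    (col c v x ≟ k ×-dec col c x a ≟ k ×-dec col c a b ≟ k ×-dec col c b y ≟ k ×-dec col c y v ≟ k)

  cycle₆? : ∀ k → Dec (Cycle₆ k)
  cycle₆? k = any? λ v → any? λ x → any? λ a → any? λ b → any? λ d → any? λ y → unique? (v ∷ x ∷ a ∷ b ∷ d ∷ y ∷ []) ×-dec
    (col c v x ≟ k ×-dec col c x a ≟ k ×-dec col c a b ≟ k ×-dec col c b d ≟ k ×-dec col c d y ≟ k ×-dec col c y v ≟ k)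

  cycle₅ : ∀ {k} → Cycle₅ k → HasMonoCycle c k 5
  cycle₅ (v , x , a , b , y , u , p , q , r , s , t) = lookup (v ∷ x ∷ a ∷ b ∷ y ∷ []) , lookup-injective u ,
    λ { zero → p ; (suc zero) → q ; (suc (suc zero)) → r ; (suc (suc (suc zero))) → s ; (suc (suc (suc (suc zero)))) → t }

  cycle₆ : ∀ {k} → Cycle₆ k → HasMonoCycle c k 6
  cycle₆ (v , x , a , b , d , y , u , p , q , r , s , t , w) = lookup (v ∷ x ∷ a ∷ b ∷ d ∷ y ∷ []) , lookup-injective u ,
    λ { zero → p ; (suc zero) → q ; (suc (suc zero)) → r ; (suc (suc (suc zero))) → s
      ; (suc (suc (suc (suc zero)))) → t ; (suc (suc (suc (suc (suc zero))))) → w }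

  -- The diagonal is given colour G so that no vertex is its own red neighbour.
  colour : Fin 15 → Fin 15 → Fin 3
  colour x y with x ≟ y
  ... | yes _ = G
  ... | no _  = col c x y

  colour-≢ : ∀ {x y} → x ≢ y → colour x y ≡ col c x y
  colour-≢ {x} {y} x≢y with x ≟ y
  ... | yes x≡y = ⊥-elim (x≢y x≡y)
  ... | no _    = refl

  colour-sym : Sym colour
  colour-sym x y with x ≟ y | y ≟ x
  ... | yes _    | yes _   = refl
  ... | yes refl | no y≢x  = ⊥-elim (y≢x refl)
  ... | no x≢y   | yes y≡x = ⊥-elim (x≢y (sym y≡x))
  ... | no x≢y   | no _    = Colouring.sym c x≢y

  colour-diagonal : ∀ x → sameColour R (colour x x) ≡ false
  colour-diagonal x with x ≟ x
  ... | yes _  = refl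
  ... | no x≢x = ⊥-elim (x≢x refl)

  colour-C₅Free : ∀ {k} → ¬ Cycle₅ k → C₅Free colour k
  colour-C₅Free absent v x a b y u@((vx ∷ _ ∷ _ ∷ vy ∷ []) ∷ (xa ∷ _) ∷ (ab ∷ _) ∷ (by ∷ []) ∷ _) p q r s t =
    absent (v , x , a , b , y , u , as vx p , as xa q , as ab r , as by s , as (λ eq → vy (sym eq)) t)
    where
    as : ∀ {x y k} → x ≢ y → colour x y ≡ k → col c x y ≡ k
    as x≢y p = ≡-trans (sym (colour-≢ x≢y)) p

  colour-C₆Free : ∀ {k} → ¬ Cycle₆ k → C₆Free colour k
  colour-C₆Free absent v x a b d y u@((vx ∷ _ ∷ _ ∷ _ ∷ vy ∷ []) ∷ (xa ∷ _) ∷ (ab ∷ _) ∷ (bd ∷ _) ∷ (dy ∷ []) ∷ _) p q r s t w =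
    absent (v , x , a , b , d , y , u , as vx p , as xa q , as ab r , as bd s , as dy t , as (λ eq → vy (sym eq)) w)
    where
    as : ∀ {x y k} → x ≢ y → colour x y ≡ k → col c x y ≡ k
    as x≢y p = ≡-trans (sym (colour-≢ x≢y)) p

  -- The existence of each cycle is decidable over the finitely many vertex tuples, so the
  -- refutation of all three absences yields an actual cycle.
  mono-cycle : Dec (Cycle₅ R) → Dec (Cycle₆ G) → Dec (Cycle₆ B) → ∃ λ a → HasMonoCycle c a (C566 a)
  mono-cycle (yes p) _       _       = R , cycle₅ p
  mono-cycle (no _)  (yes p) _       = G , cycle₆ p
  mono-cycle (no _)  (no _)  (yes p) = B , cycle₆ p
  mono-cycle (no r)  (no g)  (no b)  = ⊥-elim (Contradiction.contradiction colour (record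
    { col-sym = colour-sym ; diagonal = colour-diagonal
    ; red-free = colour-C₅Free r ; green-free = colour-C₆Free g ; blue-free = colour-C₆Free b }))

  upper : ∃ λ a → HasMonoCycle c a (C566 a)
  upper = mono-cycle (cycle₅? R) (cycle₆? G) (cycle₆? B)

-- The lower bound

not-<ᵇ : ∀ m n → (m <ᵇ n) ≡ false → n ≤ m
not-<ᵇ m n p with m <? n
... | no ¬q = ≮⇒≥ ¬q
... | yes q with ≡-trans (sym (<ᵇ-true q)) p
...   | ()

-- One formula serves every `n` up to 14: fewer vertices merely leave the blocks incomplete.
module TwoBlocks (n : ℕ) (n≤14 : n ≤ 14) where

  side : Fin n → Bool
  side i = toℕ i <ᵇ 7

  place : Fin n → ℕ
  place i = if side i then toℕ i else toℕ i ∸ 7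

  -- Places 5 and 6 of a block, outside its green K₅.
  hub : Fin n → Bool
  hub i = not (place i <ᵇ 5)

  mix : Bool → Bool → Fin 3
  mix false _     = R
  mix true  false = G
  mix true  true  = B

  sameBool-comm : ∀ x y → sameBool x y ≡ sameBool y x
  sameBool-comm true  true  = refl
  sameBool-comm true  false = refl
  sameBool-comm false true  = refl
  sameBool-comm false false = refl

  blocks : Colouring 3 n
  blocks = record
    { col = λ i j → mix (sameBool (side i) (side j)) (hub i ∨ hub j)
    ; sym = λ {i} {j} _ → cong₂ mix (sameBool-comm (side i) (side j)) (∨-comm (hub i) (hub j))
    }

  place<7 : ∀ i → place i < 7
  place<7 i with toℕ i <ᵇ 7 in eq
  ... | true  = <ᵇ⇒< _ _ (≡⇒T eq)
  ... | false = ∸-monoˡ-< (<-≤-trans (toℕ<n i) n≤14) (not-<ᵇ (toℕ i) 7 eq)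

  place-injective : ∀ i j → side i ≡ side j → place i ≡ place j → i ≡ j
  place-injective i j p q with toℕ i <ᵇ 7 in eqi | toℕ j <ᵇ 7 in eqj
  ... | true  | true  = toℕ-injective q
  ... | false | false = toℕ-injective (∸-cancelʳ-≡ (not-<ᵇ (toℕ i) 7 eqi) (not-<ᵇ (toℕ j) 7 eqj) q)

  red-edge : ∀ i j → col blocks i j ≡ R → sameBool (side i) (side j) ≡ false
  red-edge i j p with sameBool (side i) (side j) | hub i ∨ hub j | p
  ... | false | _     | _ = refl
  ... | true  | false | ()
  ... | true  | true  | ()

  green-edge : ∀ i j → col blocks i j ≡ G → side i ≡ side j × hub i ≡ false
  green-edge i j p with sameBool (side i) (side j) in eq | hub i ∨ hub j in eq′ | p
  ... | false | _     | ()
  ... | true  | true  | ()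
  ... | true  | false | _ = sameBool-sound _ _ eq , proj₁ (∨-false (hub i) eq′)

  blue-edge : ∀ i j → col blocks i j ≡ B → side i ≡ side j × (hub i ≡ true ⊎ hub j ≡ true)
  blue-edge i j p with sameBool (side i) (side j) in eq | hub i ∨ hub j in eq′ | p
  ... | false | _     | ()
  ... | true  | false | ()
  ... | true  | true  | _ = sameBool-sound _ _ eq , ∨-true (hub i) eq′

  odd-cycle : ∀ a b c d e → sameBool a b ≡ false → sameBool b c ≡ false → sameBool c d ≡ false →
              sameBool d e ≡ false → sameBool e a ≡ false → ⊥
  odd-cycle true  false true  false true  _ _ _ _ ()
  odd-cycle false true  false true  false _ _ _ _ ()

  no-red : ¬ HasMonoCycle blocks R 5
  no-red (f , _ , e) = odd-cycle (s zero) (s (suc zero)) (s (suc (suc zero))) (s (suc (suc (suc zero)))) (s (suc (suc (suc (suc zero)))))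
    (alternate zero) (alternate (suc zero)) (alternate (suc (suc zero))) (alternate (suc (suc (suc zero))))
    (alternate (suc (suc (suc (suc zero)))))
    where
    s : Fin 5 → Bool
    s i = side (f i)
    alternate : ∀ i → sameBool (s i) (s (next i)) ≡ false
    alternate i = red-edge (f i) (f (next i)) (e i)

  one-side : (f : Fin 6 → Fin n) → (∀ i → side (f i) ≡ side (f (next i))) → ∀ i j → side (f i) ≡ side (f j)
  one-side f e i j = ≡-trans (to-last i) (sym (to-last j))
    where
    e₀ = e zero
    e₁ = e (suc zero)
    e₂ = e (suc (suc zero))
    e₃ = e (suc (suc (suc zero)))
    e₄ = e (suc (suc (suc (suc zero))))
    to-last : ∀ i → side (f i) ≡ side (f (suc (suc (suc (suc (suc zero))))))
    to-last zero                                = ≡-trans e₀ (≡-trans e₁ (≡-trans e₂ (≡-trans e₃ e₄)))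
    to-last (suc zero)                          = ≡-trans e₁ (≡-trans e₂ (≡-trans e₃ e₄))
    to-last (suc (suc zero))                    = ≡-trans e₂ (≡-trans e₃ e₄)
    to-last (suc (suc (suc zero)))              = ≡-trans e₃ e₄
    to-last (suc (suc (suc (suc zero))))        = e₄
    to-last (suc (suc (suc (suc (suc zero))))) = refl

  -- A green cycle stays within one block and avoids the hubs, so its six vertices would have to
  -- share five places.
  no-green : ¬ HasMonoCycle blocks G 6
  no-green (f , inj , e) with pigeonhole (≤-refl {6}) (λ i → fromℕ< (below i))
    where
    below : ∀ i → place (f i) < 5
    below i with place (f i) <ᵇ 5 in eq | proj₂ (green-edge (f i) (f (next i)) (e i))
    ... | true | _ = <ᵇ⇒< _ _ (≡⇒T eq)
  ... | i , j , i<j , eq = <⇒≢ i<j (cong toℕ (inj (place-injective (f i) (f j)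
          (one-side f (λ k → proj₁ (green-edge (f k) (f (next k)) (e k))) i j) (fromℕ<-injective _ _ _ _ eq))))

  -- Numbers the edges 01, 23, 45 of a perfect matching of the 6-cycle by their ends.
  half : Fin 6 → Fin 3
  half zero                   = zero
  half (suc zero)             = zero
  half (suc (suc zero))       = suc zero
  half (suc (suc (suc zero))) = suc zero
  half (suc (suc (suc (suc _)))) = suc (suc zero)

  -- Every blue edge has an end in {5, 6}, so three disjoint edges of a blue cycle need three such vertices.
  no-blue : ¬ HasMonoCycle blocks B 6
  no-blue (f , inj , e) = collide (pigeonhole (≤-refl {3}) (λ k → fromℕ< (below k)))
    where
    hubOf : ∀ k → ∃ λ i → hub (f i) ≡ true × half i ≡ k
    at : ∀ i → half i ≡ half (next i) → ∃ λ j → hub (f j) ≡ true × half j ≡ half i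
    at i p with proj₂ (blue-edge (f i) (f (next i)) (e i))
    ... | inj₁ q = i , q , refl
    ... | inj₂ q = next i , q , sym p
    hubOf zero             = at zero refl
    hubOf (suc zero)       = at (suc (suc zero)) refl
    hubOf (suc (suc zero)) = at (suc (suc (suc (suc zero)))) refl
    index : Fin 3 → Fin 6
    index k = proj₁ (hubOf k)
    high : ∀ k → 5 ≤ place (f (index k))
    high k with place (f (index k)) <ᵇ 5 in eq | proj₁ (proj₂ (hubOf k))
    ... | false | _ = not-<ᵇ _ 5 eq
    below : ∀ k → place (f (index k)) ∸ 5 < 2
    below k = ∸-monoˡ-< (place<7 (f (index k))) (high k)
    separate : ∀ i j → fromℕ< (below i) ≡ fromℕ< (below j) → i ≡ j
    separate i j eq = ≡-trans (sym (proj₂ (proj₂ (hubOf i)))) (≡-trans (cong half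
      (inj (place-injective (f (index i)) (f (index j))
        (one-side f (λ k → proj₁ (blue-edge (f k) (f (next k)) (e k))) (index i) (index j))
        (∸-cancelʳ-≡ (high i) (high j) (fromℕ<-injective _ _ _ _ eq)))))
      (proj₂ (proj₂ (hubOf j))))
    collide : ¬ (∃₂ λ i j → i Fin.< j × fromℕ< (below i) ≡ fromℕ< (below j))
    collide (i , j , i<j , eq) = <⇒≢ i<j (cong toℕ (separate i j eq))

lower : ∀ n → n < 15 → ¬ Arrows n C566
lower n n<15 arrows = refute (arrows blocks)
  where
  open TwoBlocks n (≤-pred n<15)
  refute : ¬ (∃ λ a → HasMonoCycle blocks a (C566 a))
  refute (R , p) = no-red p
  refute (G , p) = no-green p
  refute (B , p) = no-blue p

theorem4 : IsCycleRamseyNumber C566 15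
theorem4 = upper , lower
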